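{- Let $S$ be any mixed subdivision of $n\Delta_{d-1}$ (not necessarily fine). Then the set of types of the cells of $S$ satisfies the elimination property: for any two cell types $A,B$ of $S$ and any $j\in[n]$ there is a cell type $C$ of $S$ with $C_j=A_j\cup B_j$ and $C_k\in\{A_k,B_k,A_k\cup B_k\}$ for all $k\in[n]$.
   Context: Let $\Delta_{d-1}=\mathrm{conv}\{e_1,\dots,e_d\}\subset\mathbb R^d$ and $\Delta_J=\mathrm{conv}\{e_j:j\in J\}$ for nonempty $J\subseteq[d]$. A mixed subdivision of $n\Delta_{d-1}$ is a polyhedral subdivision of $n\Delta_{d-1}$ into cells, each given together with a Minkowski decomposition $\Delta_{A_1}+\dots+\Delta_{A_n}$ with $\emptyset\ne A_i\subseteq[d]$; the $n$-tuple $(A_1,\dots,A_n)$ is the type of the cell. It is required that for any two cells of types $A,B$ their intersection equals $\sum_i(\Delta_{A_i}\cap\Delta_{B_i})$. It is fine if no other mixed subdivision refines it. -}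

module Defs where

open import Data.Nat using (ℕ; zero; suc)
open import Data.Fin using (Fin; zero; suc)
open import Data.Fin.Subset using (Subset; _∈_; _∉_; _∩_; _∪_; Nonempty)
open import Data.Integer using (+_)
open import Data.Rational using (ℚ; 0ℚ; 1ℚ; _+_; _*_; _≤_; _/_)
open import Data.Product using (Σ; ∃; _×_; _,_)
open import Data.Sum using (_⊎_)
open import Data.Empty using (⊥)
open import Relation.Nullary using (¬_)
open import Relation.Binary.PropositionalEquality using (_≡_)
open import Function.Bundles using (_⇔_)

-- Points of ℝ^d, taken with rational coordinates (all polytopes involved are
-- rational polytopes).
Point : ℕ → Set
Point d = Fin d → ℚ

sumFin : ∀ {m} → (Fin m → ℚ) → ℚ
sumFin {zero}  f = 0ℚ
sumFin {suc m} f = f zero + sumFin (λ i → f (suc i))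

dot : ∀ {d} → Point d → Point d → ℚ
dot c x = sumFin (λ k → c k * x k)

Region : ℕ → Set₁
Region d = Point d → Set

-- Δ_J = conv{e_j : j ∈ J}  (empty if J = ∅).
Δ : ∀ {d} → Subset d → Region d
Δ J p = (∀ k → 0ℚ ≤ p k) × (sumFin p ≡ 1ℚ) × (∀ k → k ∉ J → p k ≡ 0ℚ)

nSimplex : (n d : ℕ) → Region d
nSimplex n d x = (∀ k → 0ℚ ≤ x k) × (sumFin x ≡ (+ n) / 1)

CellType : ℕ → ℕ → Set
CellType n d = Fin n → Subset d

cell : ∀ {n d} → CellType n d → Region d
cell {n} {d} A x =
  Σ (Fin n → Point d) λ p → (∀ i → Δ (A i) (p i)) × (∀ k → x k ≡ sumFin (λ i → p i k))

_⊓_ : ∀ {d} → Region d → Region d → Region d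
(P ⊓ Q) x = P x × Q x

meetType : ∀ {n d} → CellType n d → CellType n d → CellType n d
meetType A B i = A i ∩ B i

_≐_ : ∀ {d} → Region d → Region d → Set
P ≐ Q = ∀ x → P x ⇔ Q x

IsFace : ∀ {d} → Region d → Region d → Set
IsFace {d} F P =
  (∀ x → ¬ F x) ⊎
  (Σ (Point d) λ c → ∀ x → F x ⇔ (P x × (∀ y → P y → dot c y ≤ dot c x)))

-- A mixed subdivision of nΔ_{d-1}, given by the set of types of its cells.
-- (Finiteness is automatic: there are finitely many types.)
record MixedSubdivision (n d : ℕ) : Set₁ where
  field
    IsCell      : CellType n d → Set
    nonempty    : ∀ A → IsCell A → ∀ i → Nonempty (A i)
    -- the cells cover nΔ_{d-1}  (each cell lies in nΔ_{d-1} automatically)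
    covers      : ∀ x → nSimplex n d x → Σ (CellType n d) λ A → IsCell A × cell A x
    -- closure under faces: the face of ΣΔ_{A_i} maximising c is ΣΔ_{A'_i},
    -- A'_i = argmax of c on A_i, and it is again a cell (with that type)
    faceClosed  : ∀ A → IsCell A → (c : Point d) →
                  Σ (CellType n d) λ A' → IsCell A' ×
                    (∀ i j → (j ∈ A' i) ⇔ ((j ∈ A i) × (∀ k → k ∈ A i → c k ≤ c j)))
    meetFaceˡ   : ∀ A B → IsCell A → IsCell B → IsFace (cell A ⊓ cell B) (cell A)
    meetFaceʳ   : ∀ A B → IsCell A → IsCell B → IsFace (cell A ⊓ cell B) (cell B)
    -- mixed condition: intersection equals Σ_i (Δ_{A_i} ∩ Δ_{B_i}) = Σ_i Δ_{A_i ∩ B_i}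
    meetMixed   : ∀ A B → IsCell A → IsCell B → (cell A ⊓ cell B) ≐ cell (meetType A B)

Elimination : ∀ {n d} → (CellType n d → Set) → Set
Elimination {n} {d} T =
  ∀ A B → T A → T B → (j : Fin n) →
    Σ (CellType n d) λ C → T C × (C j ≡ A j ∪ B j) ×
      (∀ k → (C k ≡ A k) ⊎ (C k ≡ B k) ⊎ (C k ≡ A k ∪ B k))

{-# OPTIONS --safe #-}
-- Margins.  A cell type D is a bipartite graph on rows [n] and columns [d], and the
-- nonnegative matrices supported on D with all row sums 1 are the Minkowski decompositions
-- of the points of the cell, the point being the vector of column sums.  Allowing arbitrary
-- row sums turns the cells into cones of margins (the Cayley trick).
--
-- Compatibility.  Two matrices with equal margins supported on cells A and B have supports
-- inside A ∩ B.  For row sums 1 this is the mixed condition.  In general one walks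
-- along a segment of margins: the cells around the carrier of a point cover all directions,
-- Fourier–Motzkin elimination shows that membership in a cone changes at finitely many
-- parameters only, and the assertion is transported from one such parameter to the next.
--
-- Elimination.  Move from A a little towards B, into the relative interior of a cell D ⊒ A.
-- In the digraph on the columns with arcs k → l for k ∈ Dᵢ, l ∈ Bᵢ, let E be a terminal
-- strong component.  Closed walks are pairs of matrices with equal margins, so by
-- compatibility Dᵢ ∩ E is ∅ or Bᵢ.  If A is the face of D selected by c, then raising c to
-- the level t on E selects a face of D whose i-th entry is Aᵢ, Aᵢ ∪ Bᵢ or Bᵢ, according to t.
-- The level at which row j is tied gives C when Dⱼ meets E; otherwise t = ∞ replaces A by a
-- cell that agrees with B in more rows.
module Submission where

open import Defs
import Data.Bool.Properties as Bool
import Data.Fin.Properties as Fin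
import Data.Integer as ℤ
import Data.Integer.Properties as ℤ
import Data.Nat.Properties as ℕ
import Data.Rational.Unnormalised.Properties as ℚᵘ
open import Data.Bool using (true; false)
open import Data.Fin using (Fin; zero; suc; combine; remQuot)
open import Data.Fin.Properties using (any?; remQuot-combine)
open import Data.Fin.Subset using (Subset; _∈_; _∉_; _∪_; ⁅_⁆; ∣_∣; Nonempty)
open import Data.Fin.Subset.Properties using (_∈?_; x∈⁅x⁆; x∈⁅y⁆⇒x≡y; x∈p∩q⁻; p⊆p∪q; q⊆p∪q; x∈p∪q⁺; x∈p∪q⁻; ∪-idem; ⊆-antisym; p⊂q⇒∣p∣<∣q∣; ∣p∣≤n)
open import Data.List using (List; []; _∷_; _++_; allFin; cartesianProduct)
open import Data.List.Membership.Propositional using () renaming (_∈_ to _∈ˡ_)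
open import Data.List.Membership.Propositional.Properties using (∈-++⁺ˡ; ∈-++⁺ʳ; ∈-++⁻; ∈-allFin; ∈-cartesianProduct⁺)
open import Data.List.Relation.Unary.Any using (here; there)
open import Data.Nat as ℕ using (ℕ; zero; suc)
open import Data.Product using (Σ; ∃; _×_; _,_; proj₁; proj₂)
open import Data.Rational using (ℚ; 0ℚ; 1ℚ; _+_; _*_; _-_; -_; _/_; 1/_; _⊔_; _≤_; _<_; NonZero; positive; nonNegative; toℚᵘ; fromℚᵘ)
open import Data.Rational.Properties as ℚ using (≤-refl; ≤-trans; ≤-reflexive; <⇒≤; _<?_)
open import Data.Rational.Unnormalised as ℚᵘ using (mkℚᵘ; *≡*)
open import Data.Sum using (_⊎_; inj₁; inj₂; [_,_]′)
open import Data.Vec using ([]; _∷_; tabulate)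
open import Data.Vec.Properties using (≡-dec; lookup⇒[]=; []=⇒lookup; lookup∘tabulate)
open import Function.Bundles using (_⇔_; Equivalence)
open import Relation.Binary using (tri<; tri≈; tri>)
open import Relation.Binary.Construct.Closure.ReflexiveTransitive using (Star; ε; _◅_; _◅◅_)
open import Relation.Binary.PropositionalEquality
open import Relation.Nullary using (¬_; Dec; does; yes; no; contradiction; ¬?; _×-dec_)
open import Relation.Nullary.Decidable using (dec⇒maybe; dec-true)
open import Relation.Unary using (Decidable)
open import Tactic.RingSolver using (solve-∀)
open import Tactic.RingSolver.Core.AlmostCommutativeRing using (AlmostCommutativeRing; fromCommutativeRing)

ℚring : AlmostCommutativeRing _ _
ℚring = fromCommutativeRing ℚ.+-*-commutativeRing (λ x → dec⇒maybe (0ℚ ℚ.≟ x))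

-- Ordered-field arithmetic

0≤+ : ∀ {a b} → 0ℚ ≤ a → 0ℚ ≤ b → 0ℚ ≤ a + b
0≤+ = ℚ.+-mono-≤

0<+ˡ : ∀ {a b} → 0ℚ < a → 0ℚ ≤ b → 0ℚ < a + b
0<+ˡ = ℚ.+-mono-<-≤

0<+ʳ : ∀ {a b} → 0ℚ ≤ a → 0ℚ < b → 0ℚ < a + b
0<+ʳ = ℚ.+-mono-≤-<

0≤* : ∀ {a b} → 0ℚ ≤ a → 0ℚ ≤ b → 0ℚ ≤ a * b
0≤* {a} {b} 0≤a 0≤b = ℚ.nonNegative⁻¹ (a * b) {{ℚ.nonNeg*nonNeg⇒nonNeg a {{nonNegative 0≤a}} b {{nonNegative 0≤b}}}}

0<* : ∀ {a b} → 0ℚ < a → 0ℚ < b → 0ℚ < a * b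
0<* {a} {b} 0<a 0<b = ℚ.positive⁻¹ (a * b) {{ℚ.pos*pos⇒pos a {{positive 0<a}} b {{positive 0<b}}}}

*-monoʳ : ∀ {a b c} → 0ℚ ≤ c → a ≤ b → c * a ≤ c * b
*-monoʳ {c = c} 0≤c = ℚ.*-monoˡ-≤-nonNeg c {{nonNegative 0≤c}}

≤⇒0≤- : ∀ {a b} → a ≤ b → 0ℚ ≤ b - a
≤⇒0≤- {a} {b} a≤b = subst (_≤ b - a) (ℚ.+-inverseʳ a) (ℚ.+-monoˡ-≤ (- a) a≤b)

<⇒0<- : ∀ {a b} → a < b → 0ℚ < b - a
<⇒0<- {a} {b} a<b = subst (_< b - a) (ℚ.+-inverseʳ a) (ℚ.+-monoˡ-< (- a) a<b)

0≤-⇒≤ : ∀ {a b} → 0ℚ ≤ b - a → a ≤ b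
0≤-⇒≤ {a} {b} h = subst₂ _≤_ (ℚ.+-identityˡ a) (cancel b a) (ℚ.+-monoˡ-≤ a h)
  where
  cancel : ∀ b a → b - a + a ≡ b
  cancel = solve-∀ ℚring

0<-⇒< : ∀ {a b} → 0ℚ < b - a → a < b
0<-⇒< {a} {b} h = subst₂ _<_ (ℚ.+-identityˡ a) (cancel b a) (ℚ.+-monoˡ-< a h)
  where
  cancel : ∀ b a → b - a + a ≡ b
  cancel = solve-∀ ℚring

-≡0⇒≡ : ∀ {a b} → a - b ≡ 0ℚ → a ≡ b
-≡0⇒≡ {a} {b} h = trans (split a b) (trans (cong (_+ b) h) (ℚ.+-identityˡ b))
  where
  split : ∀ a b → a ≡ a - b + b
  split = solve-∀ ℚring

0<1 : 0ℚ < 1ℚ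
0<1 = ℚ.positive⁻¹ 1ℚ

abstract
  recip : ∀ {a} → 0ℚ < a → ∃ λ b → 0ℚ < b × b * a ≡ 1ℚ
  recip {a} 0<a =
    (1/ a) {{nz}} , ℚ.positive⁻¹ _ {{ℚ.1/pos⇒pos a {{positive 0<a}}}} , ℚ.*-inverseˡ a {{nz}}
    where
    nz : NonZero a
    nz = ℚ.pos⇒nonZero a {{positive 0<a}}

0<*⇒≡0 : ∀ {a b} → 0ℚ < a → a * b ≡ 0ℚ → b ≡ 0ℚ
0<*⇒≡0 {a} {b} 0<a ab≡0 with c , _ , ca≡1 ← recip 0<a =
  trans (sym (ℚ.*-identityˡ b)) (trans (cong (_* b) (sym ca≡1))
    (trans (ℚ.*-assoc c a b) (trans (cong (c *_) ab≡0) (ℚ.*-zeroʳ c))))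

≤0⇒*≤0 : ∀ {a b} → 0ℚ ≤ a → b ≤ 0ℚ → a * b ≤ 0ℚ
≤0⇒*≤0 {a} 0≤a b≤0 = ≤-trans (*-monoʳ 0≤a b≤0) (≤-reflexive (ℚ.*-zeroʳ a))

<⇒≱ : ∀ {a b} → a < b → ¬ b ≤ a
<⇒≱ a<b b≤a = ℚ.<-irrefl refl (ℚ.<-≤-trans a<b b≤a)

-- Finite sums

sum-cong : ∀ {m} {f g : Fin m → ℚ} → (∀ i → f i ≡ g i) → sumFin f ≡ sumFin g
sum-cong {zero}  h = refl
sum-cong {suc m} h = cong₂ _+_ (h zero) (sum-cong λ i → h (suc i))

sum-0 : ∀ m → sumFin {m} (λ _ → 0ℚ) ≡ 0ℚ
sum-0 zero    = refl
sum-0 (suc m) = trans (ℚ.+-identityˡ _) (sum-0 m)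

sum-+ : ∀ {m} (f g : Fin m → ℚ) → sumFin (λ i → f i + g i) ≡ sumFin f + sumFin g
sum-+ {zero}  f g = refl
sum-+ {suc m} f g = trans (cong (f zero + g zero +_) (sum-+ (λ i → f (suc i)) (λ i → g (suc i))))
                          (shuffle (f zero) (g zero) _ _)
  where
  shuffle : ∀ a b c d → a + b + (c + d) ≡ a + c + (b + d)
  shuffle = solve-∀ ℚring

sum-* : ∀ {m} c (f : Fin m → ℚ) → sumFin (λ i → c * f i) ≡ c * sumFin f
sum-* {zero}  c f = sym (ℚ.*-zeroʳ c)
sum-* {suc m} c f = trans (cong (c * f zero +_) (sum-* c λ i → f (suc i)))
                          (sym (ℚ.*-distribˡ-+ c (f zero) _))

sum-swap : ∀ {m n} (f : Fin m → Fin n → ℚ) →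
           sumFin (λ i → sumFin (f i)) ≡ sumFin (λ k → sumFin (λ i → f i k))
sum-swap {zero}  {n} f = sym (sum-0 n)
sum-swap {suc m}     f = trans (cong (sumFin (f zero) +_) (sum-swap λ i → f (suc i)))
                               (sym (sum-+ (f zero) λ k → sumFin λ i → f (suc i) k))

sum-mono : ∀ {m} {f g : Fin m → ℚ} → (∀ i → f i ≤ g i) → sumFin f ≤ sumFin g
sum-mono {zero}  h = ≤-refl
sum-mono {suc m} h = ℚ.+-mono-≤ (h zero) (sum-mono λ i → h (suc i))

sum-nonneg : ∀ {m} {f : Fin m → ℚ} → (∀ i → 0ℚ ≤ f i) → 0ℚ ≤ sumFin f
sum-nonneg {m} h = ≤-trans (≤-reflexive (sym (sum-0 m))) (sum-mono h)

sum-nonpos : ∀ {m} {f : Fin m → ℚ} → (∀ i → f i ≤ 0ℚ) → sumFin f ≤ 0ℚ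
sum-nonpos {m} h = ≤-trans (sum-mono h) (≤-reflexive (sum-0 m))

term≤sum : ∀ {m} {f : Fin m → ℚ} → (∀ i → 0ℚ ≤ f i) → ∀ i → f i ≤ sumFin f
term≤sum {f = f} h zero    = ≤-trans (≤-reflexive (sym (ℚ.+-identityʳ _))) (ℚ.+-monoʳ-≤ (f zero) (sum-nonneg λ i → h (suc i)))
term≤sum {f = f} h (suc i) = ≤-trans (≤-reflexive (sym (ℚ.+-identityˡ _))) (ℚ.+-mono-≤ (h zero) (term≤sum (λ i → h (suc i)) i))

sum≤0⇒≡0 : ∀ {m} {f : Fin m → ℚ} → (∀ i → 0ℚ ≤ f i) → sumFin f ≤ 0ℚ → ∀ i → f i ≡ 0ℚ
sum≤0⇒≡0 h s≤0 i = ℚ.≤-antisym (≤-trans (term≤sum h i) s≤0) (h i)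

∃-positive-term : ∀ {m} (f : Fin m → ℚ) → 0ℚ < sumFin f → ∃ λ i → 0ℚ < f i
∃-positive-term f 0<s with any? (λ i → 0ℚ <? f i)
... | yes p = p
... | no ¬p = contradiction (sum-nonpos λ i → ℚ.≮⇒≥ λ 0<fi → ¬p (i , 0<fi)) (<⇒≱ 0<s)

-- Fourier–Motzkin elimination

-- The parameter `t` has its own slope because it is never eliminated: once all coordinates of `z`
-- are gone, forms in `t` alone remain.
record Form (N : ℕ) : Set where
  constructor form
  field
    const slope : ℚ
    coeff : Point N

open Form

⟦_⟧ : ∀ {N} → Form N → Point N → ℚ → ℚ
⟦ f ⟧ z t = const f + slope f * t + dot (coeff f) z

record Affine {N} (f : Point N → ℚ → ℚ) : Set where
  constructor affine
  field
    rep   : Form N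
    isRep : ∀ z t → f z t ≡ ⟦ rep ⟧ z t

aff-t : ∀ {N} a b → Affine {N} (λ _ t → a + b * t)
aff-t {N} a b = affine (form a b (λ _ → 0ℚ)) λ z t →
  sym (trans (cong (a + b * t +_) (trans (sum-cong λ k → ℚ.*-zeroˡ (z k)) (sum-0 N)))
             (ℚ.+-identityʳ _))

aff-+ : ∀ {N} {f g : Point N → ℚ → ℚ} → Affine f → Affine g → Affine (λ z t → f z t + g z t)
aff-+ (affine (form a b c) p) (affine (form a′ b′ c′) p′) =
  affine (form (a + a′) (b + b′) (λ k → c k + c′ k)) λ z t →
    trans (cong₂ _+_ (p z t) (p′ z t))
      (trans (shuffle a (b) t (dot c z) a′ b′ (dot c′ z))
        (cong (a + a′ + (b + b′) * t +_)
          (trans (sym (sum-+ (λ k → c k * z k) λ k → c′ k * z k))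
                 (sum-cong λ k → sym (ℚ.*-distribʳ-+ (z k) (c k) (c′ k))))))
  where
  shuffle : ∀ a b t x a′ b′ x′ → (a + b * t + x) + (a′ + b′ * t + x′) ≡ a + a′ + (b + b′) * t + (x + x′)
  shuffle = solve-∀ ℚring

aff-* : ∀ {N} {f : Point N → ℚ → ℚ} s → Affine f → Affine (λ z t → s * f z t)
aff-* s (affine (form a b c) p) =
  affine (form (s * a) (s * b) (λ k → s * c k)) λ z t →
    trans (cong (s *_) (p z t)) (trans (distrib s a b t (dot c z))
      (cong (s * a + s * b * t +_)
        (trans (sym (sum-* s λ k → c k * z k)) (sum-cong λ k → sym (ℚ.*-assoc s (c k) (z k))))))
  where
  distrib : ∀ s a b t x → s * (a + b * t + x) ≡ s * a + s * b * t + s * x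
  distrib = solve-∀ ℚring

unit : ∀ {N} → Fin N → Point N
unit zero    zero    = 1ℚ
unit zero    (suc _) = 0ℚ
unit (suc k) zero    = 0ℚ
unit (suc k) (suc l) = unit k l

dot-unit : ∀ {N} (k : Fin N) (z : Point N) → dot (unit k) z ≡ z k
dot-unit {suc N} zero    z = trans (cong₂ _+_ (ℚ.*-identityˡ (z zero)) (trans (sum-cong λ l → ℚ.*-zeroˡ (z (suc l))) (sum-0 N)))
                                   (ℚ.+-identityʳ (z zero))
dot-unit {suc N} (suc k) z = trans (cong₂ _+_ (ℚ.*-zeroˡ (z zero)) (dot-unit k λ l → z (suc l))) (ℚ.+-identityˡ _)

aff-var : ∀ {N} (k : Fin N) → Affine (λ z _ → z k)
aff-var k = affine (form 0ℚ 0ℚ (unit k)) λ z t → sym (trans (cong (0ℚ + 0ℚ * t +_) (dot-unit k z)) (drop t (z k)))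
  where
  drop : ∀ t x → 0ℚ + 0ℚ * t + x ≡ x
  drop = solve-∀ ℚring

aff-sum : ∀ {N m} {f : Fin m → Point N → ℚ → ℚ} → (∀ i → Affine (f i)) → Affine (λ z t → sumFin λ i → f i z t)
aff-sum {m = zero}  h with affine r p ← aff-t 0ℚ 0ℚ = affine r λ z t → trans (drop t) (p z t)
  where
  drop : ∀ t → 0ℚ ≡ 0ℚ + 0ℚ * t
  drop = solve-∀ ℚring
aff-sum {m = suc m} h = aff-+ (h zero) (aff-sum λ i → h (suc i))

-- Sets cut out by finitely many weak affine inequalities. Equations, finite conjunctions and, by
-- Fourier-Motzkin, existential quantification stay in this class.
record Poly {N} (P : Point N → ℚ → Set) : Set where
  constructor poly
  field
    forms : List (Form N)
    to    : ∀ {z t} → P z t → ∀ {f} → f ∈ˡ forms → 0ℚ ≤ ⟦ f ⟧ z t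
    from  : ∀ {z t} → (∀ {f} → f ∈ˡ forms → 0ℚ ≤ ⟦ f ⟧ z t) → P z t

module _ {N : ℕ} where

  poly-map : {P Q : Point N → ℚ → Set} → (∀ {z t} → P z t → Q z t) → (∀ {z t} → Q z t → P z t) → Poly P → Poly Q
  poly-map p⇒q q⇒p (poly fs to from) = poly fs (λ q → to (q⇒p q)) (λ h → p⇒q (from h))

  poly-× : {P Q : Point N → ℚ → Set} → Poly P → Poly Q → Poly (λ z t → P z t × Q z t)
  poly-× (poly fs to from) (poly gs to′ from′) = poly (fs ++ gs)
    (λ (p , q) f∈ → [ to p , to′ q ]′ (∈-++⁻ fs f∈))
    (λ h → from (λ f∈ → h (∈-++⁺ˡ f∈)) , from′ (λ f∈ → h (∈-++⁺ʳ fs f∈)))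

  poly-≥0 : {f : Point N → ℚ → ℚ} → Affine f → Poly (λ z t → 0ℚ ≤ f z t)
  poly-≥0 {f} (affine r p) = poly (r ∷ [])
    (λ { {z} {t} h (here refl) → subst (0ℚ ≤_) (p z t) h })
    (λ {z} {t} h → subst (0ℚ ≤_) (sym (p z t)) (h (here refl)))

  poly-≡ : {f g : Point N → ℚ → ℚ} → Affine f → Affine g → Poly (λ z t → f z t ≡ g z t)
  poly-≡ {f} {g} F G = poly-map
    (λ (h , h′) → ℚ.≤-antisym (le h′) (le h))
    (λ eq → ge (≤-reflexive (sym eq)) , ge (≤-reflexive eq))
    (poly-× (poly-≥0 (aff-+ F (aff-* (- 1ℚ) G))) (poly-≥0 (aff-+ G (aff-* (- 1ℚ) F))))
    where
    minus : ∀ a b → a - b ≡ a + - 1ℚ * b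
    minus = solve-∀ ℚring
    le : ∀ {a b} → 0ℚ ≤ a + - 1ℚ * b → b ≤ a
    le {a} {b} h = 0≤-⇒≤ (subst (0ℚ ≤_) (sym (minus a b)) h)
    ge : ∀ {a b} → b ≤ a → 0ℚ ≤ a + - 1ℚ * b
    ge {a} {b} h = subst (0ℚ ≤_) (minus a b) (≤⇒0≤- h)

  -- The condition `B` depends on neither `z` nor `t`, so it is decided once and the constraint is
  -- kept or dropped.
  poly-dec : {B : Set} {P : Point N → ℚ → Set} → Dec B → Poly P → Poly (λ z t → B → P z t)
  poly-dec (yes b) = poly-map (λ p _ → p) (λ h → h b)
  poly-dec (no ¬b) _ = poly [] (λ _ ()) (λ _ b → contradiction b ¬b)

  poly-∀ : {X : Set} {P : X → Point N → ℚ → Set} (xs : List X) →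
           (∀ x → Poly (P x)) → Poly (λ z t → ∀ {x} → x ∈ˡ xs → P x z t)
  poly-∀ []       h = poly [] (λ _ ()) (λ _ ())
  poly-∀ {P = P} (x ∷ xs) h = poly-map join (λ r → r (here refl) , (λ x∈ → r (there x∈)))
    (poly-× (h x) (poly-∀ xs h))
    where
    join : ∀ {z t} → P x z t × (∀ {y} → y ∈ˡ xs → P y z t) → ∀ {y} → y ∈ˡ x ∷ xs → P y z t
    join (p , q) (here refl) = p
    join (p , q) (there y∈)  = q y∈

  poly-∀Fin : ∀ {m} {P : Fin m → Point N → ℚ → Set} → (∀ i → Poly (P i)) → Poly (λ z t → ∀ i → P i z t)
  poly-∀Fin {m} h = poly-map (λ f i → f (∈-allFin i)) (λ f {i} _ → f i) (poly-∀ (allFin m) h)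

module _ {X : Set} (α β : X → ℚ) where

  -- Elimination of `s` from the constraints `0 ≤ α x + β x * s`: those without `s` are kept, and
  -- every lower bound is added to every upper bound with the multipliers that cancel `s`.
  Feasible : List X → Set
  Feasible xs = (∀ {x} → x ∈ˡ xs → β x ≡ 0ℚ → 0ℚ ≤ α x)
    × (∀ {x} → x ∈ˡ xs → ∀ {y} → y ∈ˡ xs → 0ℚ < β x → β y < 0ℚ → 0ℚ ≤ β x * α y + - β y * α x)

  Solves : List X → ℚ → Set
  Solves xs s = ∀ {x} → x ∈ˡ xs → 0ℚ ≤ α x + β x * s

  solves⇒feasible : ∀ {xs s} → Solves xs s → Feasible xs
  solves⇒feasible {xs} {s} h =
    (λ {x} x∈ βx≡0 → subst (0ℚ ≤_) (trans (cong (λ b → α x + b * s) βx≡0) (drop (α x) s)) (h x∈)) ,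
    (λ {x} x∈ {y} y∈ 0<βx βy<0 → subst (0ℚ ≤_) (combo (α x) (β x) (α y) (β y) s)
      (0≤+ (0≤* (<⇒≤ 0<βx) (h y∈)) (0≤* (<⇒≤ (ℚ.neg-antimono-< βy<0)) (h x∈))))
    where
    drop : ∀ a s → a + 0ℚ * s ≡ a
    drop = solve-∀ ℚring
    combo : ∀ a b a′ b′ s → b * (a′ + b′ * s) + - b′ * (a + b * s) ≡ b * a′ + - b′ * a
    combo = solve-∀ ℚring

  root : ∀ x → ¬ β x ≡ 0ℚ → ∃ λ ρ → ∀ s → α x + β x * s ≡ β x * (s - ρ)
  root x βx≢0 with ℚ.<-cmp (β x) 0ℚ
  ... | tri≈ _ βx≡0 _ = contradiction βx≡0 βx≢0
  ... | tri> _ _ 0<βx with c , _ , cβ≡1 ← recip 0<βx = - (c * α x) , λ s →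
          trans (cong (λ e → e + β x * s) (trans (sym (ℚ.*-identityˡ (α x))) (cong (_* α x) (sym cβ≡1)))) (factor c (β x) (α x) s)
    where
    factor : ∀ c b a s → c * b * a + b * s ≡ b * (s - - (c * a))
    factor = solve-∀ ℚring
  ... | tri< βx<0 _ _ with c , _ , cβ≡1 ← recip (ℚ.neg-antimono-< βx<0) = c * α x , λ s →
          trans (cong (λ e → e + β x * s) (trans (sym (ℚ.*-identityˡ (α x))) (cong (_* α x) (sym cβ≡1)))) (factor c (β x) (α x) s)
    where
    factor : ∀ c b a s → c * - b * a + b * s ≡ b * (s - c * a)
    factor = solve-∀ ℚring

  at-root : ∀ x (r : ∃ λ ρ → ∀ s → α x + β x * s ≡ β x * (s - ρ)) → α x ≡ - (β x * proj₁ r)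
  at-root x (ρ , r) = trans (drop (α x) (β x)) (trans (r 0ℚ) (neg (β x) ρ))
    where
    drop : ∀ a b → a ≡ a + b * 0ℚ
    drop = solve-∀ ℚring
    neg : ∀ b ρ → b * (0ℚ - ρ) ≡ - (b * ρ)
    neg = solve-∀ ℚring

  -- If the solution of the tail violates the new constraint, the root of the
  -- new constraint is a solution.
  feasible⇒solves : ∀ xs → Feasible xs → ∃ (Solves xs)
  feasible⇒solves [] _ = 0ℚ , λ ()
  feasible⇒solves (x ∷ xs) (flat , pair)
    with s , sol ← feasible⇒solves xs ((λ y∈ → flat (there y∈)) , (λ y∈ y′∈ → pair (there y∈) (there y′∈)))
    with 0ℚ ℚ.≤? α x + β x * s
  ... | yes ok = s , λ { (here refl) → ok ; (there y∈) → sol y∈ }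
  ... | no bad with ℚ.<-cmp (β x) 0ℚ
  ... | tri≈ _ βx≡0 _ = contradiction
          (subst (0ℚ ≤_) (trans (drop (α x) s) (cong (λ b → α x + b * s) (sym βx≡0))) (flat (here refl) βx≡0)) bad
    where
    drop : ∀ a s → a ≡ a + 0ℚ * s
    drop = solve-∀ ℚring
  ... | tri> _ βx≢0 0<βx with r@(ρ , eq) ← root x βx≢0 = ρ , λ
      { (here refl) → ≤-reflexive (sym (trans (eq ρ) (vanish (β x) ρ)))
      ; (there {xs = _} y∈) → tail y∈ }
    where
    vanish : ∀ b ρ → b * (ρ - ρ) ≡ 0ℚ
    vanish = solve-∀ ℚring
    s<ρ : s < ρ
    s<ρ = ℚ.≰⇒> λ ρ≤s → bad (subst (0ℚ ≤_) (sym (eq s)) (0≤* (<⇒≤ 0<βx) (≤⇒0≤- ρ≤s)))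
    swap : ∀ b a′ b′ ρ → b * a′ + - b′ * - (b * ρ) ≡ b * (a′ + b′ * ρ)
    swap = solve-∀ ℚring
    shift : ∀ a b s ρ → a + b * s + b * (ρ - s) ≡ a + b * ρ
    shift = solve-∀ ℚring
    -- Constraints with `β y ≥ 0` do not decrease on the way from `s` up to `ρ`. An upper bound is
    -- handled by its pairing with `x`: since `x` vanishes at `ρ`, the pairing equals `β x` times
    -- the value of `y` there.
    tail : ∀ {y} → y ∈ˡ xs → 0ℚ ≤ α y + β y * ρ
    tail {y} y∈ with β y <? 0ℚ
    ... | yes βy<0 = ℚ.*-cancelˡ-≤-pos (β x) {{positive 0<βx}} (≤-trans (≤-reflexive (ℚ.*-zeroʳ (β x)))
            (subst (0ℚ ≤_) (trans (cong (λ a → β x * α y + - β y * a) (at-root x r)) (swap (β x) (α y) (β y) ρ))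
              (pair (here refl) (there y∈) 0<βx βy<0)))
    ... | no βy≮0 = subst (0ℚ ≤_) (shift (α y) (β y) s ρ)
            (0≤+ (sol y∈) (0≤* (ℚ.≮⇒≥ βy≮0) (≤⇒0≤- (<⇒≤ s<ρ))))
  ... | tri< βx<0 βx≢0 _ with r@(ρ , eq) ← root x βx≢0 = ρ , λ
      { (here refl) → ≤-reflexive (sym (trans (eq ρ) (vanish (β x) ρ)))
      ; (there {xs = _} y∈) → tail y∈ }
    where
    vanish : ∀ b ρ → b * (ρ - ρ) ≡ 0ℚ
    vanish = solve-∀ ℚring
    -βx>0 : 0ℚ < - β x
    -βx>0 = ℚ.neg-antimono-< βx<0
    flip : ∀ b s ρ → b * (s - ρ) ≡ - b * (ρ - s)
    flip = solve-∀ ℚring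
    ρ<s : ρ < s
    ρ<s = ℚ.≰⇒> λ s≤ρ → bad (subst (0ℚ ≤_) (sym (trans (eq s) (flip (β x) s ρ))) (0≤* (<⇒≤ -βx>0) (≤⇒0≤- s≤ρ)))
    swap : ∀ b a′ b′ ρ → b′ * - (b * ρ) + - b * a′ ≡ - b * (a′ + b′ * ρ)
    swap = solve-∀ ℚring
    shift : ∀ a b s ρ → a + b * s + - b * (s - ρ) ≡ a + b * ρ
    shift = solve-∀ ℚring
    tail : ∀ {y} → y ∈ˡ xs → 0ℚ ≤ α y + β y * ρ
    tail {y} y∈ with 0ℚ <? β y
    ... | yes 0<βy = ℚ.*-cancelˡ-≤-pos (- β x) {{positive -βx>0}} (≤-trans (≤-reflexive (ℚ.*-zeroʳ (- β x)))
            (subst (0ℚ ≤_) (trans (cong (λ a → β y * a + - β x * α y) (at-root x r)) (swap (β x) (α y) (β y) ρ))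
              (pair (there y∈) (here refl) 0<βy βx<0)))
    ... | no βy≯0 = subst (0ℚ ≤_) (shift (α y) (β y) s ρ)
            (0≤+ (sol y∈) (0≤* (ℚ.neg-antimono-≤ (ℚ.≮⇒≥ βy≯0)) (≤⇒0≤- (<⇒≤ ρ<s))))

infixr 5 _◂_
_◂_ : ∀ {N} → ℚ → Point N → Point (suc N)
(s ◂ z) zero    = s
(s ◂ z) (suc k) = z k

-- The coefficient of the eliminated variable is a constant, so the feasibility conditions are again
-- affine in `z` and `t`, with case distinctions that do not depend on them.
poly-∃ : ∀ {N} {P : Point (suc N) → ℚ → Set} → Poly P → Poly (λ z t → ∃ λ s → P (s ◂ z) t)
poly-∃ {N} {P} (poly fs to from) = poly-map
  (λ {z} {t} feas → let s , sol = feasible⇒solves (α z t) β fs feas in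
     s , from (λ {f} f∈ → subst (0ℚ ≤_) (sym (expand f s z t)) (sol f∈)))
  (λ {z} {t} (s , p) → solves⇒feasible (α z t) β {xs = fs} λ {f} f∈ → subst (0ℚ ≤_) (expand f s z t) (to p f∈))
  (poly-×
    (poly-∀ fs λ f → poly-dec (β f ℚ.≟ 0ℚ) (poly-≥0 (affα f)))
    (poly-∀ fs λ f → poly-∀ fs λ g → poly-dec (0ℚ <? β f) (poly-dec (β g <? 0ℚ)
      (poly-≥0 (aff-+ (aff-* (β f) (affα g)) (aff-* (- β g) (affα f)))))))
  where
  tailForm : Form (suc N) → Form N
  tailForm (form a b c) = form a b (λ k → c (suc k))
  α : Point N → ℚ → Form (suc N) → ℚ
  α z t f = ⟦ tailForm f ⟧ z t
  affα : ∀ f → Affine (λ z t → α z t f)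
  affα f = affine (tailForm f) λ _ _ → refl
  β : Form (suc N) → ℚ
  β f = coeff f zero
  expand : ∀ f s z t → ⟦ f ⟧ (s ◂ z) t ≡ α z t f + β f * s
  expand f s z t = shuffle (const f + slope f * t) (β f * s) (dot (λ k → coeff f (suc k)) z)
    where
    shuffle : ∀ u v w → u + (v + w) ≡ u + w + v
    shuffle = solve-∀ ℚring

-- A point agrees with its head put before its tail only pointwise; hence the hypothesis that `P`
-- respects pointwise equality.
poly-∃* : ∀ N {P : Point N → ℚ → Set} → (∀ {z z′ t} → (∀ k → z k ≡ z′ k) → P z t → P z′ t) →
          Poly P → Poly {zero} (λ _ t → ∃ λ z → P z t)
poly-∃* zero    resp p = poly-map (λ {z} h → z , h) (λ (z , h) → resp (λ ()) h) p
poly-∃* (suc N) resp p = poly-map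
  (λ (z , s , h) → s ◂ z , h)
  (λ (z , h) → (λ k → z (suc k)) , z zero , resp (λ { zero → refl ; (suc _) → refl }) h)
  (poly-∃* N (λ eq (s , h) → s , resp (λ { zero → refl ; (suc k) → eq k }) h) (poly-∃ p))

-- Going from t to t′ does not lead through ρ; starting at ρ counts as
-- passing through it, arriving at ρ does not.
Avoids : ℚ → ℚ → ℚ → Set
Avoids ρ t t′ = ¬ (t ≤ ρ × ρ < t′) × ¬ (t′ < ρ × ρ ≤ t)

-- A weak inequality can fail on leaving a root but not on arriving at one. The asymmetry of
-- `Avoids` therefore permits limits, such as passing from a small positive parameter to 0.
ChangesOnlyAt : List ℚ → (ℚ → Set) → Set
ChangesOnlyAt L T = ∀ {t t′} → T t → (∀ {ρ} → ρ ∈ˡ L → Avoids ρ t t′) → T t′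

weakenˡ : ∀ {L L′ T} → ChangesOnlyAt L T → ChangesOnlyAt (L ++ L′) T
weakenˡ c h av = c h (λ ρ∈ → av (∈-++⁺ˡ ρ∈))

weakenʳ : ∀ {L′ T} L → ChangesOnlyAt L′ T → ChangesOnlyAt (L ++ L′) T
weakenʳ L c h av = c h (λ ρ∈ → av (∈-++⁺ʳ L ρ∈))

-- Without variables every form is affine in `t`: it is constant or changes sign at its only root.
poly-roots : ∀ {T : ℚ → Set} → Poly {zero} (λ _ t → T t) → ∃ λ L → ChangesOnlyAt L T
poly-roots {T} (poly fs to from) = proj₁ (go fs) ,
  λ h av → from {z = λ ()} (proj₂ (go fs) (λ f∈ → to {z = λ ()} h f∈) av)
  where
  S : List (Form zero) → ℚ → Set
  S fs t = ∀ {f} → f ∈ˡ fs → 0ℚ ≤ ⟦ f ⟧ (λ ()) t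
  drop : ∀ a b s → a + b * s + 0ℚ ≡ a + b * s
  drop = solve-∀ ℚring
  one : ∀ f → ∃ λ L → ChangesOnlyAt L (λ t → 0ℚ ≤ const f + slope f * t)
  one f with slope f ℚ.≟ 0ℚ
  ... | yes b≡0 = [] , λ {t} {t′} h _ → ≤-trans h (≤-reflexive (flat t t′))
    where
    flat : ∀ t t′ → const f + slope f * t ≡ const f + slope f * t′
    flat t t′ = cong (const f +_) (trans (cong (_* t) b≡0) (trans (ℚ.*-zeroˡ t) (sym (trans (cong (_* t′) b≡0) (ℚ.*-zeroˡ t′)))))
  ... | no b≢0 with ρ , eq ← root const slope f b≢0 = ρ ∷ [] , λ {t} {t′} h av →
      subst (0ℚ ≤_) (sym (eq t′)) (sign (subst (0ℚ ≤_) (eq t) h) (av (here refl)))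
    where
    sign : ∀ {t t′} → 0ℚ ≤ slope f * (t - ρ) → Avoids ρ t t′ → 0ℚ ≤ slope f * (t′ - ρ)
    sign {t} {t′} h (up , down) with ℚ.<-cmp (slope f) 0ℚ
    ... | tri≈ _ b≡0 _ = contradiction b≡0 b≢0
    ... | tri> _ _ 0<b = 0≤* (<⇒≤ 0<b) (≤⇒0≤- (ℚ.≮⇒≥ λ t′<ρ → down (t′<ρ ,
            0≤-⇒≤ (ℚ.*-cancelˡ-≤-pos (slope f) {{positive 0<b}} (≤-trans (≤-reflexive (ℚ.*-zeroʳ (slope f))) h)))))
    ... | tri< b<0 _ _ = subst (0ℚ ≤_) (sym (flip (slope f) t′ ρ)) (0≤* (<⇒≤ 0<-b) (≤⇒0≤- (ℚ.≮⇒≥ λ ρ<t′ → up (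
            0≤-⇒≤ (ℚ.*-cancelˡ-≤-pos (- slope f) {{positive 0<-b}} (≤-trans (≤-reflexive (ℚ.*-zeroʳ (- slope f))) (subst (0ℚ ≤_) (flip (slope f) t ρ) h))) , ρ<t′))))
      where
      0<-b : 0ℚ < - slope f
      0<-b = ℚ.neg-antimono-< b<0
      flip : ∀ b s ρ → b * (s - ρ) ≡ - b * (ρ - s)
      flip = solve-∀ ℚring
  go : ∀ fs → ∃ λ L → ChangesOnlyAt L (S fs)
  go [] = [] , λ _ _ ()
  go (f ∷ fs) with L , c ← one f | L′ , c′ ← go fs = L ++ L′ , λ {t} {t′} h av →
    λ { (here refl) → subst (0ℚ ≤_) (sym (drop (const f) (slope f) t′))
            (weakenˡ {T = λ t → 0ℚ ≤ const f + slope f * t} c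
              (subst (0ℚ ≤_) (drop (const f) (slope f) t) (h (here refl))) av)
      ; (there f∈) → weakenʳ {T = S fs} L c′ (λ f∈ → h (there f∈)) av f∈ }

-- One list serves all supports at once, so a walk can be cut at its critical parameters before the
-- cells met on it are known.
roots-∀Subset : ∀ {m} {T : Subset m → ℚ → Set} → (∀ D → ∃ λ L → ChangesOnlyAt L (T D)) →
                ∃ λ L → ∀ D → ChangesOnlyAt L (T D)
roots-∀Subset {zero} h with L , c ← h [] = L , λ { [] → c }
roots-∀Subset {suc m} {T} h
  with L , c ← roots-∀Subset (λ D → h (true ∷ D)) | L′ , c′ ← roots-∀Subset (λ D → h (false ∷ D)) =
  L ++ L′ , λ { (true ∷ D) → weakenˡ {T = T (true ∷ D)} (c D) ; (false ∷ D) → weakenʳ {T = T (false ∷ D)} L (c′ D) }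

-- Subsets given by decidable predicates

module _ {m} {P : Fin m → Set} (P? : Decidable P) where

  setOf : Subset m
  setOf = tabulate λ e → does (P? e)

  ∈-setOf⁺ : ∀ {e} → P e → e ∈ setOf
  ∈-setOf⁺ {e} p = lookup⇒[]= e setOf (trans (lookup∘tabulate _ e) (dec-true (P? e) p))

  ∈-setOf⁻ : ∀ {e} → e ∈ setOf → P e
  ∈-setOf⁻ {e} e∈ with P? e | trans (sym (lookup∘tabulate (λ e → does (P? e)) e)) ([]=⇒lookup e∈)
  ... | yes p | _ = p

-- Matrices and their margins

Mat : ℕ → ℕ → Set
Mat n d = Fin n → Fin d → ℚ

module _ {n d : ℕ} where

  infix  4 _~_
  infixl 6 _⊕_
  infixl 7 _⊙_

  rowSum : Mat n d → Fin n → ℚ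
  rowSum r i = sumFin (r i)

  colSum : Mat n d → Fin d → ℚ
  colSum r k = sumFin λ i → r i k

  _⊕_ : Mat n d → Mat n d → Mat n d
  (r ⊕ s) i k = r i k + s i k

  _⊙_ : ℚ → Mat n d → Mat n d
  (c ⊙ r) i k = c * r i k

  record _~_ (r s : Mat n d) : Set where
    constructor _,_
    field
      rows : ∀ i → rowSum r i ≡ rowSum s i
      cols : ∀ k → colSum r k ≡ colSum s k

  open _~_ public

  ~-pointwise : ∀ {r s} → (∀ i k → r i k ≡ s i k) → r ~ s
  ~-pointwise h = (λ i → sum-cong (h i)) , (λ k → sum-cong λ i → h i k)

  ~-refl : ∀ {r} → r ~ r
  ~-refl = ~-pointwise λ _ _ → refl

  ~-sym : ∀ {r s} → r ~ s → s ~ r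
  ~-sym (p , q) = (λ i → sym (p i)) , (λ k → sym (q k))

  ~-trans : ∀ {r s u} → r ~ s → s ~ u → r ~ u
  ~-trans (p , q) (p′ , q′) = (λ i → trans (p i) (p′ i)) , (λ k → trans (q k) (q′ k))

  ~-⊕ : ∀ {r s r′ s′} → r ~ s → r′ ~ s′ → r ⊕ r′ ~ s ⊕ s′
  ~-⊕ {r} {s} {r′} {s′} (p , q) (p′ , q′) =
    (λ i → trans (sum-+ (r i) (r′ i)) (trans (cong₂ _+_ (p i) (p′ i)) (sym (sum-+ (s i) (s′ i))))) ,
    (λ k → trans (sum-+ (λ i → r i k) (λ i → r′ i k)) (trans (cong₂ _+_ (q k) (q′ k)) (sym (sum-+ (λ i → s i k) (λ i → s′ i k)))))

  ~-⊙ : ∀ {r s} c → r ~ s → c ⊙ r ~ c ⊙ s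
  ~-⊙ {r} {s} c (p , q) =
    (λ i → trans (sum-* c (r i)) (trans (cong (c *_) (p i)) (sym (sum-* c (s i))))) ,
    (λ k → trans (sum-* c (λ i → r i k)) (trans (cong (c *_) (q k)) (sym (sum-* c (λ i → s i k)))))

  rowSum-line : ∀ P c Q i → rowSum (P ⊕ c ⊙ Q) i ≡ rowSum P i + rowSum Q i * c
  rowSum-line P c Q i = trans (sum-+ (P i) _) (cong (rowSum P i +_) (trans (sum-* c (Q i)) (ℚ.*-comm c _)))

  colSum-line : ∀ P c Q k → colSum (P ⊕ c ⊙ Q) k ≡ colSum P k + colSum Q k * c
  colSum-line P c Q k = trans (sum-+ (λ i → P i k) _) (cong (colSum P k +_) (trans (sum-* c (λ i → Q i k)) (ℚ.*-comm c _)))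

  record On (D : CellType n d) (r : Mat n d) : Set where
    constructor _,_
    field
      nonneg : ∀ i k → 0ℚ ≤ r i k
      off    : ∀ i k → k ∉ D i → r i k ≡ 0ℚ

  open On public

  -- Margins of such a matrix lie in the relative interior of the cone of `D`; those of a matrix
  -- with `On D r` lie in the closed cone.
  record Strict (D : CellType n d) (r : Mat n d) : Set where
    constructor _,_
    field
      pos  : ∀ i k → k ∈ D i → 0ℚ < r i k
      off′ : ∀ i k → k ∉ D i → r i k ≡ 0ℚ

  open Strict public

  strict⇒on : ∀ {D r} → Strict D r → On D r
  strict⇒on {D} {r} (p , o) = nn , o
    where
    nn : ∀ i k → 0ℚ ≤ r i k
    nn i k with k ∈? D i
    ... | yes k∈ = <⇒≤ (p i k k∈)
    ... | no  k∉ = ≤-reflexive (sym (o i k k∉))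

  pos⇒∈ : ∀ {D r} → On D r → ∀ {i k} → 0ℚ < r i k → k ∈ D i
  pos⇒∈ {D} on {i} {k} 0<r with k ∈? D i
  ... | yes k∈ = k∈
  ... | no  k∉ = contradiction (≤-reflexive (off on i k k∉)) (<⇒≱ 0<r)

  _⊑_ : CellType n d → CellType n d → Set
  A ⊑ D = ∀ i {k} → k ∈ A i → k ∈ D i

  on-mono : ∀ {A D r} → A ⊑ D → On A r → On D r
  on-mono A⊑D (nn , o) = nn , λ i k k∉ → o i k λ k∈ → k∉ (A⊑D i k∈)

  on-⊕ : ∀ {D r s} → On D r → On D s → On D (r ⊕ s)
  on-⊕ (nn , o) (nn′ , o′) = (λ i k → 0≤+ (nn i k) (nn′ i k)) ,
    λ i k k∉ → trans (cong₂ _+_ (o i k k∉) (o′ i k k∉)) (ℚ.+-identityˡ 0ℚ)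

  on-⊙ : ∀ {D r c} → 0ℚ ≤ c → On D r → On D (c ⊙ r)
  on-⊙ {c = c} 0≤c (nn , o) = (λ i k → 0≤* 0≤c (nn i k)) ,
    λ i k k∉ → trans (cong (c *_) (o i k k∉)) (ℚ.*-zeroʳ c)

  strict-⊕ : ∀ {D r s} → Strict D r → On D s → Strict D (r ⊕ s)
  strict-⊕ (p , o) (nn′ , o′) = (λ i k k∈ → 0<+ˡ (p i k k∈) (nn′ i k)) ,
    λ i k k∉ → trans (cong₂ _+_ (o i k k∉) (o′ i k k∉)) (ℚ.+-identityˡ 0ℚ)

  InCone : CellType n d → Mat n d → Set
  InCone D M = ∃ λ r → On D r × r ~ M

  abstract
    -- Membership of the margins of `P ⊕ t ⊙ Q` in a cone is solvability of a system in the `n * d`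
    -- matrix entries that is affine in `t`. Eliminating the entries leaves conditions on `t` with
    -- finitely many roots.
    cone-roots : ∀ P Q → ∃ λ L → ∀ D → ChangesOnlyAt L (λ t → InCone D (P ⊕ t ⊙ Q))
    cone-roots P Q = proj₁ allRoots , λ D h av → to D (proj₂ allRoots (mask D) (from D h) av)
      where
      Sys : Subset (n ℕ.* d) → Point (n ℕ.* d) → ℚ → Set
      Sys S y t = (∀ e → 0ℚ ≤ y e) × (∀ e → e ∉ S → y e ≡ 0ℚ)
        × (∀ i → sumFin (λ k → y (combine i k)) ≡ rowSum P i + rowSum Q i * t)
        × (∀ k → sumFin (λ i → y (combine {n} i k)) ≡ colSum P k + colSum Q k * t)
      respSys : ∀ {S y y′ t} → (∀ e → y e ≡ y′ e) → Sys S y t → Sys S y′ t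
      respSys eq (a , b , c , e) = (λ k → subst (0ℚ ≤_) (eq k) (a k)) , (λ k k∉ → trans (sym (eq k)) (b k k∉)) ,
        (λ i → trans (sum-cong λ k → sym (eq (combine i k))) (c i)) , (λ k → trans (sum-cong λ i → sym (eq (combine {n} i k))) (e k))
      dec∉ : ∀ {m} (e : Fin m) S → Dec (e ∉ S)
      dec∉ e S with e ∈? S
      ... | yes e∈ = no λ e∉ → e∉ e∈
      ... | no e∉  = yes e∉
      system : ∀ S → Poly (Sys S)
      system S = poly-× (poly-∀Fin λ e → poly-≥0 (aff-var e))
        (poly-× (poly-∀Fin λ e → poly-dec (dec∉ e S) (poly-≡ (aff-var e) zeroA))
        (poly-× (poly-∀Fin λ i → poly-≡ (aff-sum λ k → aff-var (combine i k)) (aff-t (rowSum P i) (rowSum Q i)))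
                (poly-∀Fin λ k → poly-≡ (aff-sum λ i → aff-var (combine {n} i k)) (aff-t (colSum P k) (colSum Q k)))))
        where
        drop : ∀ t → 0ℚ ≡ 0ℚ + 0ℚ * t
        drop = solve-∀ ℚring
        zeroA : Affine {n ℕ.* d} (λ _ _ → 0ℚ)
        zeroA = affine (Affine.rep (aff-t 0ℚ 0ℚ)) λ z t → trans (drop t) (Affine.isRep (aff-t 0ℚ 0ℚ) z t)
      Edge : CellType n d → Fin (n ℕ.* d) → Set
      Edge D e = proj₂ (remQuot {n} d e) ∈ D (proj₁ (remQuot {n} d e))
      edge? : ∀ D → Decidable (Edge D)
      edge? D e = proj₂ (remQuot {n} d e) ∈? D (proj₁ (remQuot {n} d e))
      -- Encoding the cell type as a set of edges makes the supports enumerable by `roots-∀Subset`.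
      mask : CellType n d → Subset (n ℕ.* d)
      mask D = setOf (edge? D)
      edge-combine : ∀ D i k → Edge D (combine i k) → k ∈ D i
      edge-combine D i k = subst (λ (i , k) → k ∈ D i) (remQuot-combine {n} i k)
      from : ∀ D {t} → InCone D (P ⊕ t ⊙ Q) → ∃ λ y → Sys (mask D) y t
      from D {t} (r , (nn , o) , (rs , cs)) = y , (λ e → nn _ _) , (λ e e∉ → o _ _ λ h → e∉ (∈-setOf⁺ (edge? D) h)) ,
        (λ i → trans (sum-cong λ k → yc i k) (trans (rs i) (rowSum-line P t Q i))) ,
        (λ k → trans (sum-cong λ i → yc i k) (trans (cs k) (colSum-line P t Q k)))
        where
        y : Point (n ℕ.* d)
        y e = r (proj₁ (remQuot {n} d e)) (proj₂ (remQuot {n} d e))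
        yc : ∀ i k → y (combine i k) ≡ r i k
        yc i k = cong (λ (i , k) → r i k) (remQuot-combine {n} i k)
      to : ∀ D {t} → (∃ λ y → Sys (mask D) y t) → InCone D (P ⊕ t ⊙ Q)
      to D {t} (y , nn , o , rs , cs) = (λ i k → y (combine i k)) ,
        ((λ i k → nn (combine i k)) , (λ i k k∉ → o (combine i k) λ h → k∉ (edge-combine D i k (∈-setOf⁻ (edge? D) h)))) ,
        ((λ i → trans (rs i) (sym (rowSum-line P t Q i))) , (λ k → trans (cs k) (sym (colSum-line P t Q k))))

      allRoots : ∃ λ L → ∀ S → ChangesOnlyAt L (λ t → ∃ λ y → Sys S y t)
      allRoots = roots-∀Subset (λ S → poly-roots (poly-∃* (n ℕ.* d) (respSys {S}) (system S)))

  -- Weights of the form `γ i - c k` are the dual variables of a transportation problem: they see a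
  -- matrix only through its margins.
  pairing : (γ : Fin n → ℚ) (c : Fin d → ℚ) (r : Mat n d) →
            sumFin (λ i → sumFin λ k → r i k * (γ i - c k))
              ≡ sumFin (λ i → γ i * rowSum r i) + - 1ℚ * sumFin (λ k → c k * colSum r k)
  pairing γ c r = begin
    sumFin (λ i → sumFin λ k → r i k * (γ i - c k))
      ≡⟨ sum-cong (λ i → sum-cong λ k → split (r i k) (γ i) (c k)) ⟩
    sumFin (λ i → sumFin λ k → γ i * r i k + - 1ℚ * (c k * r i k))
      ≡⟨ sum-cong (λ i → sum-+ (λ k → γ i * r i k) _) ⟩
    sumFin (λ i → sumFin (λ k → γ i * r i k) + sumFin (λ k → - 1ℚ * (c k * r i k)))
      ≡⟨ sum-+ (λ i → sumFin (λ k → γ i * r i k)) _ ⟩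
    sumFin (λ i → sumFin (λ k → γ i * r i k)) + sumFin (λ i → sumFin (λ k → - 1ℚ * (c k * r i k)))
      ≡⟨ cong₂ _+_ (sum-cong λ i → sum-* (γ i) (r i)) (trans (sum-cong λ i → sum-* (- 1ℚ) λ k → c k * r i k) (sum-* (- 1ℚ) λ i → sumFin λ k → c k * r i k)) ⟩
    sumFin (λ i → γ i * rowSum r i) + - 1ℚ * sumFin (λ i → sumFin (λ k → c k * r i k))
      ≡⟨ cong (λ e → sumFin (λ i → γ i * rowSum r i) + - 1ℚ * e)
           (trans (sum-swap λ i k → c k * r i k) (sum-cong λ k → sum-* (c k) λ i → r i k)) ⟩
    sumFin (λ i → γ i * rowSum r i) + - 1ℚ * sumFin (λ k → c k * colSum r k) ∎
    where
    open ≡-Reasoning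
    split : ∀ r g c → r * (g - c) ≡ g * r + - 1ℚ * (c * r)
    split = solve-∀ ℚring

  pairing-~ : ∀ γ c {r s} → r ~ s →
              sumFin (λ i → sumFin λ k → r i k * (γ i - c k)) ≡ sumFin (λ i → sumFin λ k → s i k * (γ i - c k))
  pairing-~ γ c {r} {s} (p , q) = trans (pairing γ c r) (trans
    (cong₂ (λ u v → u + - 1ℚ * v) (sum-cong λ i → cong (γ i *_) (p i)) (sum-cong λ k → cong (c k *_) (q k)))
    (sym (pairing γ c s)))

  -- Equal margins give equal sums, of which one is nonnegative and the other nonpositive. Both
  -- vanish, and since the terms of each have constant sign, so does every term.
  complementary-slackness : ∀ γ c {r s} → r ~ s →
    (∀ i k → 0ℚ ≤ r i k * (γ i - c k)) → (∀ i k → s i k * (γ i - c k) ≤ 0ℚ) →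
    (∀ i k → r i k * (γ i - c k) ≡ 0ℚ) × (∀ i k → s i k * (γ i - c k) ≡ 0ℚ)
  complementary-slackness γ c {r} {s} r~s r≥ s≤ = r≡0 , s≡0
    where
    S≤0 : sumFin (λ i → sumFin λ k → s i k * (γ i - c k)) ≤ 0ℚ
    S≤0 = sum-nonpos λ i → sum-nonpos (s≤ i)
    R≥0 : 0ℚ ≤ sumFin (λ i → sumFin λ k → r i k * (γ i - c k))
    R≥0 = sum-nonneg λ i → sum-nonneg (r≥ i)
    eq = pairing-~ γ c r~s
    r≡0 : ∀ i k → r i k * (γ i - c k) ≡ 0ℚ
    r≡0 i = sum≤0⇒≡0 (r≥ i) (≤-reflexive (sum≤0⇒≡0 (λ i → sum-nonneg (r≥ i)) (≤-trans (≤-reflexive eq) S≤0) i))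
    neg≥ : ∀ i k → 0ℚ ≤ - 1ℚ * (s i k * (γ i - c k))
    neg≥ i k = subst (0ℚ ≤_) (flip (s i k * (γ i - c k))) (≤⇒0≤- (s≤ i k))
      where
      flip : ∀ x → 0ℚ - x ≡ - 1ℚ * x
      flip = solve-∀ ℚring
    negsum : sumFin (λ i → sumFin λ k → - 1ℚ * (s i k * (γ i - c k))) ≤ 0ℚ
    negsum = ≤-trans (≤-reflexive (trans (sum-cong λ i → sum-* (- 1ℚ) λ k → s i k * (γ i - c k)) (sum-* (- 1ℚ) λ i → sumFin λ k → s i k * (γ i - c k))))
      (subst (_≤ 0ℚ) (flip (sumFin λ i → sumFin λ k → s i k * (γ i - c k))) (ℚ.neg-antimono-≤ (≤-trans R≥0 (≤-reflexive eq))))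
      where
      flip : ∀ x → - x ≡ - 1ℚ * x
      flip = solve-∀ ℚring
    s≡0 : ∀ i k → s i k * (γ i - c k) ≡ 0ℚ
    s≡0 i k = ℚ.neg-injective (trans (flip (s i k * (γ i - c k)))
        (sum≤0⇒≡0 (neg≥ i) (≤-reflexive (sum≤0⇒≡0 (λ i → sum-nonneg (neg≥ i)) negsum i)) k))
      where
      flip : ∀ x → - x ≡ - 1ℚ * x
      flip = solve-∀ ℚring

-- Reachability in finite digraphs

module Reach {m : ℕ} (R : Fin m → Fin m → Set) (R? : ∀ a b → Dec (R a b)) where

  ReachSet : Fin m → Set
  ReachSet k = Σ (Subset m) λ J → k ∈ J × (∀ {a b} → a ∈ J → R a b → b ∈ J) × (∀ {a} → a ∈ J → Star R k a)

  -- Each round adds a new vertex, which preserves `m ≤ ∣ J ∣ + fuel`. With no fuel left `J` already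
  -- has `m` elements and cannot grow.
  grow : ∀ fuel k (J : Subset m) → m ℕ.≤ ∣ J ∣ ℕ.+ fuel → k ∈ J → (∀ {a} → a ∈ J → Star R k a) →
         ReachSet k
  grow fuel k J m≤ k∈J reached
    with any? (λ a → any? (λ b → a ∈? J ×-dec R? a b ×-dec ¬? (b ∈? J)))
  ... | no ¬p = J , k∈J , closed , reached
    where
    closed : ∀ {a b} → a ∈ J → R a b → b ∈ J
    closed {a} {b} a∈ ab with b ∈? J
    ... | yes b∈ = b∈
    ... | no  b∉ = contradiction (a , b , a∈ , ab , b∉) ¬p
  ... | yes (a , b , a∈ , ab , b∉) = next fuel m≤
    where
    J′ = J ∪ ⁅ b ⁆
    bigger : ∣ J ∣ ℕ.< ∣ J′ ∣
    bigger = p⊂q⇒∣p∣<∣q∣ (p⊆p∪q ⁅ b ⁆ , b , q⊆p∪q J ⁅ b ⁆ (x∈⁅x⁆ b) , b∉)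
    reached′ : ∀ {c} → c ∈ J′ → Star R k c
    reached′ {c} c∈ with x∈p∪q⁻ J ⁅ b ⁆ c∈
    ... | inj₁ c∈J = reached c∈J
    ... | inj₂ c∈b with refl ← x∈⁅y⁆⇒x≡y b c∈b = reached a∈ ◅◅ ab ◅ ε
    next : ∀ fuel → m ℕ.≤ ∣ J ∣ ℕ.+ fuel → ReachSet k
    next zero       h = contradiction (ℕ.≤-trans bigger (ℕ.≤-trans (∣p∣≤n J′) (subst (m ℕ.≤_) (ℕ.+-identityʳ _) h))) (ℕ.<-irrefl refl)
    next (suc fuel) h = grow fuel k J′
      (ℕ.≤-trans h (subst (ℕ._≤ ∣ J′ ∣ ℕ.+ fuel) (sym (ℕ.+-suc ∣ J ∣ fuel)) (ℕ.+-monoˡ-≤ fuel bigger)))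
      (p⊆p∪q ⁅ b ⁆ k∈J) reached′

  abstract
    grown : ∀ k → ReachSet k
    grown k = grow m k ⁅ k ⁆ (ℕ.m≤n+m m ∣ ⁅ k ⁆ ∣) (x∈⁅x⁆ k)
                (λ a∈ → subst (Star R k) (sym (x∈⁅y⁆⇒x≡y k a∈)) ε)

  reach : Fin m → Subset m
  reach k = proj₁ (grown k)

  self∈reach : ∀ k → k ∈ reach k
  self∈reach k = proj₁ (proj₂ (grown k))

  reach-closed : ∀ k {a b} → a ∈ reach k → R a b → b ∈ reach k
  reach-closed k = proj₁ (proj₂ (proj₂ (grown k)))

  reach⇒star : ∀ k {a} → a ∈ reach k → Star R k a
  reach⇒star k = proj₂ (proj₂ (proj₂ (grown k)))

  star-closed : ∀ (P : Fin m → Set) → (∀ {a b} → P a → R a b → P b) → ∀ {a b} → P a → Star R a b → P b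
  star-closed P step pa ε        = pa
  star-closed P step pa (r ◅ rs) = star-closed P step (step pa r) rs

  star⇒reach : ∀ {k a} → Star R k a → a ∈ reach k
  star⇒reach {k} = star-closed (_∈ reach k) (reach-closed k) (self∈reach k)

  abstract
    -- While some vertex reachable from `k` does not lead back to `k`, continue from that vertex:
    -- its reachable set is strictly smaller because it lacks `k`.
    terminal : ∀ k → ∃ λ l → Star R k l × (∀ {a} → a ∈ reach l → Star R a l)
    terminal k = go ∣ reach k ∣ k ℕ.≤-refl
      where
      go : ∀ fuel k → ∣ reach k ∣ ℕ.≤ fuel → ∃ λ l → Star R k l × (∀ {a} → a ∈ reach l → Star R a l)
      go fuel k h with any? (λ a → a ∈? reach k ×-dec ¬? (k ∈? reach a))
      ... | no ¬p = k , ε , back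
        where
        back : ∀ {a} → a ∈ reach k → Star R a k
        back {a} a∈ with k ∈? reach a
        ... | yes k∈ = reach⇒star a k∈
        ... | no  k∉ = contradiction (a , a∈ , k∉) ¬p
      ... | yes (a , a∈ , k∉) = descend fuel h
        where
        smaller : ∣ reach a ∣ ℕ.< ∣ reach k ∣
        smaller = p⊂q⇒∣p∣<∣q∣ ((λ b∈ → star⇒reach (reach⇒star k a∈ ◅◅ reach⇒star a b∈)) , k , self∈reach k , k∉)
        descend : ∀ fuel → ∣ reach k ∣ ℕ.≤ fuel → ∃ λ l → Star R k l × (∀ {a} → a ∈ reach l → Star R a l)
        descend zero       h = contradiction (ℕ.≤-trans smaller h) λ ()
        descend (suc fuel) h with l , a⟶l , back ← go fuel a (ℕ.≤-pred (ℕ.≤-trans smaller h)) =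
          l , reach⇒star k a∈ ◅◅ a⟶l , back

-- Sufficiently small positive rationals

Small : (ℚ → Set) → Set
Small P = ∃ λ δ → 0ℚ < δ × (∀ {η} → 0ℚ < η → η ≤ δ → P η)

abstract
  small-× : ∀ {P Q} → Small P → Small Q → Small (λ η → P η × Q η)
  small-× (δ , 0<δ , p) (δ′ , 0<δ′ , q) with ℚ.≤-total δ δ′
  ... | inj₁ δ≤δ′ = δ  , 0<δ  , λ 0<η η≤ → p 0<η η≤ , q 0<η (≤-trans η≤ δ≤δ′)
  ... | inj₂ δ′≤δ = δ′ , 0<δ′ , λ 0<η η≤ → p 0<η (≤-trans η≤ δ′≤δ) , q 0<η η≤

  small-∀ : ∀ {m} {P : Fin m → ℚ → Set} → (∀ i → Small (P i)) → Small (λ η → ∀ i → P i η)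
  small-∀ {zero}  h = 1ℚ , 0<1 , λ _ _ ()
  small-∀ {suc m} h with δ , 0<δ , p ← small-× (h zero) (small-∀ (λ i → h (suc i))) =
    δ , 0<δ , λ 0<η η≤ → λ { zero → proj₁ (p 0<η η≤) ; (suc i) → proj₂ (p 0<η η≤) i }

  small-* : ∀ a {b} → 0ℚ ≤ a → 0ℚ < b → Small (λ η → η * a ≤ b)
  -- The bound is `b / (1 + a)`, where the summand 1 admits `a = 0`.
  small-* a {b} 0≤a 0<b with c , 0<c , c[1+a]≡1 ← recip (0<+ˡ 0<1 0≤a) = b * c , 0<* 0<b 0<c , λ {η} 0<η η≤ →
    ≤-trans (≤-trans (≤-reflexive (ℚ.*-comm η a)) (*-monoʳ 0≤a η≤))
      (0≤-⇒≤ (≤-trans (<⇒≤ (0<* 0<b 0<c)) (≤-reflexive (trans (expand a b c)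
        (cong (_- a * (b * c)) (trans (cong (b *_) c[1+a]≡1) (ℚ.*-identityʳ b)))))))
    where
    expand : ∀ a b c → b * c ≡ b * (c * (1ℚ + a)) - a * (b * c)
    expand = solve-∀ ℚring

  -- On the way from `η > 0` down to 0 a root `ρ ≤ 0` is at most arrived at; a positive root is
  -- avoided by starting below it.
  small-avoids₁ : ∀ ρ → Small (λ η → Avoids ρ η 0ℚ)
  small-avoids₁ ρ with 0ℚ <? ρ
  ... | no ρ≯0 = 1ℚ , 0<1 , λ 0<η _ →
    (λ (η≤ρ , ρ<0) → ρ≯0 (ℚ.<-≤-trans 0<η η≤ρ)) , (λ (0<ρ , _) → ρ≯0 0<ρ)
  ... | yes 0<ρ with δ , 0<δ , δ<ρ ← ℚ.<-dense 0<ρ = δ , 0<δ , λ 0<η η≤δ →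
    (λ (η≤ρ , ρ<0) → ℚ.<-asym 0<ρ ρ<0) , (λ (_ , ρ≤η) → <⇒≱ δ<ρ (≤-trans ρ≤η η≤δ))

  small-avoids : ∀ L → Small (λ η → ∀ {ρ} → ρ ∈ˡ L → Avoids ρ η 0ℚ)
  small-avoids []      = 1ℚ , 0<1 , λ _ _ ()
  small-avoids (ρ ∷ L) with δ , 0<δ , p ← small-× (small-avoids₁ ρ) (small-avoids L) =
    δ , 0<δ , λ 0<η η≤ → λ { (here refl) → proj₁ (p 0<η η≤) ; (there ρ∈) → proj₂ (p 0<η η≤) ρ∈ }

-- The points of `L` are treated one at a time: a point inside the interval splits it into two
-- steps, and a point outside imposes nothing.
backward-induction : ∀ {G : ℚ → Set} {lo hi} (L : List ℚ) →
  (∀ {s e} → lo ≤ s → s < e → e ≤ hi → (∀ {ρ} → ρ ∈ˡ L → ¬ (s < ρ × ρ < e)) → G e → G s) →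
  ∀ {s e} → lo ≤ s → s < e → e ≤ hi → G e → G s
backward-induction []      step lo≤s s<e e≤hi = step lo≤s s<e e≤hi λ ()
backward-induction {G} {lo} {hi} (ρ ∷ L) step = backward-induction {G} L λ {s} {e} → step′ {s} {e}
  where
  step′ : ∀ {s e} → lo ≤ s → s < e → e ≤ hi → (∀ {σ} → σ ∈ˡ L → ¬ (s < σ × σ < e)) → G e → G s
  step′ {s} {e} lo≤s s<e e≤hi none g with s <? ρ | ρ <? e
  ... | yes s<ρ | yes ρ<e = step lo≤s s<ρ (≤-trans (<⇒≤ ρ<e) e≤hi)
          (λ { (here refl) (_ , ρ<ρ) → ℚ.<-irrefl refl ρ<ρ ; (there σ∈) (s<σ , σ<ρ) → none σ∈ (s<σ , ℚ.<-trans σ<ρ ρ<e) })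
          (step (≤-trans lo≤s (<⇒≤ s<ρ)) ρ<e e≤hi
            (λ { (here refl) (ρ<ρ , _) → ℚ.<-irrefl refl ρ<ρ ; (there σ∈) (ρ<σ , σ<e) → none σ∈ (ℚ.<-trans s<ρ ρ<σ , σ<e) }) g)
  ... | no s≮ρ | _ = step lo≤s s<e e≤hi (λ { (here refl) (s<ρ , _) → s≮ρ s<ρ ; (there σ∈) → none σ∈ }) g
  ... | yes _ | no ρ≮e = step lo≤s s<e e≤hi (λ { (here refl) (_ , ρ<e) → ρ≮e ρ<e ; (there σ∈) → none σ∈ }) g

-- Indicators, ranks and unit vectors

𝟙 : ∀ {P : Set} → Dec P → ℚ
𝟙 (yes _) = 1ℚ
𝟙 (no  _) = 0ℚ

𝟙-yes : ∀ {P : Set} (p? : Dec P) → P → 𝟙 p? ≡ 1ℚ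
𝟙-yes (yes _) p = refl
𝟙-yes (no ¬p) p = contradiction p ¬p

𝟙-no : ∀ {P : Set} (p? : Dec P) → ¬ P → 𝟙 p? ≡ 0ℚ
𝟙-no (yes p) ¬p = contradiction p ¬p
𝟙-no (no _)  ¬p = refl

0≤𝟙 : ∀ {P : Set} (p? : Dec P) → 0ℚ ≤ 𝟙 p?
0≤𝟙 (yes _) = <⇒≤ 0<1
0≤𝟙 (no _)  = ≤-refl

𝟙≤1 : ∀ {P : Set} (p? : Dec P) → 𝟙 p? ≤ 1ℚ
𝟙≤1 (yes _) = ≤-refl
𝟙≤1 (no _)  = <⇒≤ 0<1

𝟙-mono : ∀ {P Q : Set} (p? : Dec P) (q? : Dec Q) → (P → Q) → 𝟙 p? ≤ 𝟙 q?
𝟙-mono (yes p) (yes q) h = ≤-refl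
𝟙-mono (yes p) (no ¬q) h = contradiction (h p) ¬q
𝟙-mono (no _)  q?      h = 0≤𝟙 q?

-- Ranks select the same faces as c, but their range and gaps are bounded independently of c.
rank : ∀ {m} → Point m → Point m
rank c k = sumFin λ l → 𝟙 (c l <? c k)

0≤rank : ∀ {m} (c : Point m) k → 0ℚ ≤ rank c k
0≤rank c k = sum-nonneg λ l → 0≤𝟙 (c l <? c k)

rank≤ : ∀ {m} (c : Point m) k → rank c k ≤ sumFin {m} (λ _ → 1ℚ)
rank≤ c k = sum-mono λ l → 𝟙≤1 (c l <? c k)

rank-mono : ∀ {m} (c : Point m) {k l} → c k ≤ c l → rank c k ≤ rank c l
rank-mono c ck≤cl = sum-mono λ a → 𝟙-mono (c a <? c _) (c a <? c _) λ a<k → ℚ.<-≤-trans a<k ck≤cl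

-- Whatever counts towards the rank of `k` also counts towards that of `l`, and `k` itself counts
-- only for `l`.
rank-gap : ∀ {m} (c : Point m) {k l} → c k < c l → 1ℚ ≤ rank c l - rank c k
rank-gap {m} c {k} {l} ck<cl = ≤-trans (≤-trans (≤-reflexive (sym one)) (term≤sum diff≥0 k)) (≤-reflexive total)
  where
  diff : Point m
  diff a = 𝟙 (c a <? c l) + - 1ℚ * 𝟙 (c a <? c k)
  minus : ∀ x y → x - y ≡ x + - 1ℚ * y
  minus = solve-∀ ℚring
  diff≥0 : ∀ a → 0ℚ ≤ diff a
  diff≥0 a = subst (0ℚ ≤_) (minus (𝟙 (c a <? c l)) (𝟙 (c a <? c k)))
    (≤⇒0≤- (𝟙-mono (c a <? c k) (c a <? c l) λ a<k → ℚ.<-trans a<k ck<cl))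
  one : diff k ≡ 1ℚ
  one = cong₂ (λ x y → x + - 1ℚ * y) (𝟙-yes (c k <? c l) ck<cl) (𝟙-no (c k <? c k) (ℚ.<-irrefl refl))
  total : sumFin diff ≡ rank c l - rank c k
  total = trans (sum-+ (λ a → 𝟙 (c a <? c l)) _) (trans (cong (rank c l +_) (sum-* (- 1ℚ) λ a → 𝟙 (c a <? c k)))
    (sym (minus (rank c l) (rank c k))))

unit-self : ∀ {m} (k : Fin m) → unit k k ≡ 1ℚ
unit-self zero    = refl
unit-self (suc k) = unit-self k

unit-other : ∀ {m} {k l : Fin m} → ¬ k ≡ l → unit k l ≡ 0ℚ
unit-other {k = zero}  {zero}  k≢l = contradiction refl k≢l
unit-other {k = zero}  {suc l} k≢l = refl
unit-other {k = suc k} {zero}  k≢l = refl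
unit-other {k = suc k} {suc l} k≢l = unit-other λ k≡l → k≢l (cong suc k≡l)

0≤unit : ∀ {m} (k l : Fin m) → 0ℚ ≤ unit k l
0≤unit k l with k Fin.≟ l
... | yes refl = ≤-trans (<⇒≤ 0<1) (≤-reflexive (sym (unit-self k)))
... | no  k≢l  = ≤-reflexive (sym (unit-other k≢l))

sum-unit : ∀ {m} (k : Fin m) → sumFin (unit k) ≡ 1ℚ
sum-unit k = trans (sum-cong λ l → sym (ℚ.*-identityʳ (unit k l))) (dot-unit k λ _ → 1ℚ)

-- Moving weight inside a row, and linear functionals on cells

module _ {n d : ℕ} where

  move : Fin n → Fin d → Fin d → Mat n d
  move i a b x y = unit i x * (unit b y - unit a y)

  rowSum-move : ∀ i a b x → rowSum (move i a b) x ≡ 0ℚ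
  rowSum-move i a b x = trans (sum-* (unit i x) λ y → unit b y - unit a y)
    (trans (cong (unit i x *_) (trans (sum-cong λ y → minus (unit b y) (unit a y))
      (trans (sum-+ (unit b) (λ y → - 1ℚ * unit a y))
        (cong₂ _+_ (sum-unit b) (trans (sum-* (- 1ℚ) (unit a)) (cong (- 1ℚ *_) (sum-unit a)))))))
      (ℚ.*-zeroʳ (unit i x)))
    where
    minus : ∀ x y → x - y ≡ x + - 1ℚ * y
    minus = solve-∀ ℚring

  colSum-move : ∀ i a b y → colSum (move i a b) y ≡ unit b y - unit a y
  colSum-move i a b y = trans (sum-cong λ x → ℚ.*-comm (unit i x) (unit b y - unit a y))
    (trans (sum-* (unit b y - unit a y) (unit i)) (trans (cong ((unit b y - unit a y) *_) (sum-unit i))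
      (ℚ.*-identityʳ (unit b y - unit a y))))

  -- Row sums are 0 and column sums forget the row, so moves made in various rows can be relocated
  -- to a single one without changing the margins.
  move-~ : ∀ i i′ a b → move i a b ~ move i′ a b
  move-~ i i′ a b =
    (λ x → trans (rowSum-move i a b x) (sym (rowSum-move i′ a b x))) ,
    (λ y → trans (colSum-move i a b y) (sym (colSum-move i′ a b y)))

  -- The move takes one unit from the entry `(i , a)`, and `c` scales that entry to exactly 1.
  on-move : ∀ {D r c i a b} → On D r → b ∈ D i → 0ℚ < c → c * r i a ≡ 1ℚ → On D (c ⊙ r ⊕ move i a b)
  on-move {D} {r} {c} {i} {a} {b} on b∈ 0<c cr≡1 = nn , oo
    where
    a∈ : a ∈ D i
    a∈ with a ∈? D i
    ... | yes a∈ = a∈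
    ... | no a∉  = contradiction (trans (sym cr≡1) (trans (cong (c *_) (off on i a a∉)) (ℚ.*-zeroʳ c))) ℚ.1≢0
    zeroʳ : ∀ z u v → z + 0ℚ * (u - v) ≡ z
    zeroʳ = solve-∀ ℚring
    other : ∀ z u → z + u ≡ z + 1ℚ * (u - 0ℚ)
    other = solve-∀ ℚring
    same : ∀ u → u ≡ 1ℚ + 1ℚ * (u - 1ℚ)
    same = solve-∀ ℚring
    nn : ∀ x y → 0ℚ ≤ c * r x y + move i a b x y
    nn x y with i Fin.≟ x
    ... | no i≢x = ≤-trans (0≤* (<⇒≤ 0<c) (nonneg on x y)) (≤-reflexive (sym
            (trans (cong (λ u → c * r x y + u * (unit b y - unit a y)) (unit-other i≢x)) (zeroʳ (c * r x y) (unit b y) (unit a y)))))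
    ... | yes refl with a Fin.≟ y
    ... | yes refl = ≤-trans (0≤unit b a) (≤-reflexive (trans (same (unit b a))
            (trans (cong (_+ 1ℚ * (unit b a - 1ℚ)) (sym cr≡1)) (cong₂ (λ u v → c * r i a + u * (unit b a - v)) (sym (unit-self i)) (sym (unit-self a))))))
    ... | no a≢y = ≤-trans (0≤+ (0≤* (<⇒≤ 0<c) (nonneg on i y)) (0≤unit b y)) (≤-reflexive (trans (other (c * r i y) (unit b y))
            (cong₂ (λ u v → c * r i y + u * (unit b y - v)) (sym (unit-self i)) (sym (unit-other a≢y)))))
    cancel : ∀ c u → c * 0ℚ + u * (0ℚ - 0ℚ) ≡ 0ℚ
    cancel = solve-∀ ℚring
    cancel′ : ∀ c v → c * 0ℚ + 0ℚ * v ≡ 0ℚ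
    cancel′ = solve-∀ ℚring
    oo : ∀ x y → y ∉ D x → c * r x y + move i a b x y ≡ 0ℚ
    oo x y y∉ with i Fin.≟ x
    ... | no i≢x = trans (cong₂ (λ u v → c * u + v * (unit b y - unit a y)) (off on x y y∉) (unit-other i≢x)) (cancel′ c (unit b y - unit a y))
    ... | yes refl = trans (cong₂ (λ u v → c * u + unit i i * v) (off on i y y∉)
            (cong₂ _-_ (unit-other {k = b} {y} λ { refl → y∉ b∈ }) (unit-other {k = a} {y} λ { refl → y∉ a∈ }))) (cancel c (unit i i))

  dot-colSum : (c : Point d) (r : Mat n d) (γ : Fin n → ℚ) → sumFin (λ i → γ i * rowSum r i) ≡
               dot c (colSum r) + sumFin (λ i → sumFin λ k → r i k * (γ i - c k))
  dot-colSum c r γ = trans (rearrange (sumFin λ i → γ i * rowSum r i) (dot c (colSum r))) (cong (dot c (colSum r) +_) (sym (pairing γ c r)))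
    where
    rearrange : ∀ x y → x ≡ y + (x + - 1ℚ * y)
    rearrange = solve-∀ ℚring

  tight : ∀ {F : CellType n d} {r : Mat n d} (c : Point d) (γ : Fin n → ℚ) → On F r → (∀ i k → k ∈ F i → c k ≡ γ i) →
          ∀ i k → r i k * (γ i - c k) ≡ 0ℚ
  tight {F} {r} c γ on h i k with k ∈? F i
  ... | yes k∈ = trans (cong (λ e → r i k * (γ i - e)) (h i k k∈)) (trans (cong (r i k *_) (ℚ.+-inverseʳ (γ i))) (ℚ.*-zeroʳ (r i k)))
  ... | no  k∉ = trans (cong (_* (γ i - c k)) (off on i k k∉)) (ℚ.*-zeroˡ (γ i - c k))

  dot-on : ∀ {A r} (c : Point d) (γ : Fin n → ℚ) → On A r → (∀ i k → k ∈ A i → c k ≡ γ i) →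
           dot c (colSum r) ≡ sumFin (λ i → γ i * rowSum r i)
  dot-on {A} {r} c γ on h = sym (trans (dot-colSum c r γ)
    (trans (cong (dot c (colSum r) +_) (trans (sum-cong λ i → trans (sum-cong (tight c γ on h i)) (sum-0 d)) (sum-0 n)))
      (ℚ.+-identityʳ _)))

  on-slack : ∀ {D r} (c : Point d) (γ : Fin n → ℚ) → On D r → (∀ i k → k ∈ D i → c k ≤ γ i) →
             ∀ i k → 0ℚ ≤ r i k * (γ i - c k)
  on-slack {D} {r} c γ on h i k with k ∈? D i
  ... | yes k∈ = 0≤* (nonneg on i k) (≤⇒0≤- (h i k k∈))
  ... | no  k∉ = ≤-reflexive (sym (trans (cong (_* (γ i - c k)) (off on i k k∉)) (ℚ.*-zeroˡ (γ i - c k))))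

  dot-on-≤ : ∀ {D r} (c : Point d) (γ : Fin n → ℚ) → On D r → (∀ i k → k ∈ D i → c k ≤ γ i) →
             dot c (colSum r) ≤ sumFin (λ i → γ i * rowSum r i)
  dot-on-≤ {D} {r} c γ on h = ≤-trans
    (≤-trans (≤-reflexive (sym (ℚ.+-identityʳ _)))
      (ℚ.+-monoʳ-≤ (dot c (colSum r)) (sum-nonneg λ i → sum-nonneg (on-slack c γ on h i))))
    (≤-reflexive (sym (dot-colSum c r γ)))

  -- Stochastic matrices, cells and faces

  Stochastic : Mat n d → Set
  Stochastic r = ∀ i → rowSum r i ≡ 1ℚ

  abstract
    barycenter : ∀ A → (∀ i → Nonempty (A i)) → ∃ λ a → Strict A a × Stochastic a
    barycenter A ne = (λ i k → w i * 𝟙 (k ∈? A i)) ,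
      ((λ i k k∈ → 0<* (0<w i) (subst (0ℚ <_) (sym (𝟙-yes (k ∈? A i) k∈)) 0<1)) ,
       (λ i k k∉ → trans (cong (w i *_) (𝟙-no (k ∈? A i) k∉)) (ℚ.*-zeroʳ (w i)))) ,
      (λ i → trans (sum-* (w i) λ k → 𝟙 (k ∈? A i)) (proj₂ (proj₂ (inv i))))
      where
      inv : ∀ i → ∃ λ b → 0ℚ < b × b * sumFin (λ k → 𝟙 (k ∈? A i)) ≡ 1ℚ
      inv i with k , k∈ ← ne i = recip (ℚ.<-≤-trans (subst (0ℚ <_) (sym (𝟙-yes (k ∈? A i) k∈)) 0<1)
        (term≤sum (λ k → 0≤𝟙 (k ∈? A i)) k))
      w : Fin n → ℚ
      w i = proj₁ (inv i)
      0<w : ∀ i → 0ℚ < w i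
      0<w i = proj₁ (proj₂ (inv i))

  on⇒cell : ∀ {A r} → On A r → Stochastic r → cell A (colSum r)
  on⇒cell {r = r} on st = r , (λ i → nonneg on i , st i , off on i) , λ k → refl

  cell⇒on : ∀ {A x} → cell A x → ∃ λ r → On A r × Stochastic r × (∀ k → x k ≡ colSum r k)
  cell⇒on (r , h , eq) = r , ((λ i → proj₁ (h i)) , λ i → proj₂ (proj₂ (h i))) , (λ i → proj₁ (proj₂ (h i))) , eq

  inCone⇒cell : ∀ {A M} → Stochastic M → InCone A M → cell A (colSum M)
  inCone⇒cell st (r , on , rs , cs) = r , (λ i → nonneg on i , trans (rs i) (st i) , off on i) , λ k → sym (cs k)

  -- Putting all possible weight on one vertex recovers a cell type from its region.
  ⊆-cell⇒⊑ : ∀ {A G} → (∀ i → Nonempty (G i)) → A ⊑ G → (∀ x → cell G x → cell A x) → G ⊑ A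
  ⊆-cell⇒⊑ {A} {G} ne A⊑G sub i {l} l∈ = go (cell⇒on (sub (colSum e) (on⇒cell e-on e-st)))
    where
    g  = proj₁ (barycenter G ne)
    gS = proj₁ (proj₂ (barycenter G ne))
    g1 = proj₂ (proj₂ (barycenter G ne))
    e : Mat n d
    e x y with l ∈? G x
    ... | yes _ = unit l y
    ... | no  _ = g x y
    e-on : On G e
    nonneg e-on x y with l ∈? G x
    ... | yes _ = 0≤unit l y
    ... | no  _ = nonneg (strict⇒on gS) x y
    off e-on x y y∉ with l ∈? G x
    ... | yes l∈ = unit-other {k = l} {y} λ { refl → y∉ l∈ }
    ... | no  _  = off′ gS x y y∉
    e-st : Stochastic e
    e-st x with l ∈? G x
    ... | yes _ = sum-unit l
    ... | no  _ = g1 x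
    -- With these potentials against `unit l`, the matrix `e` has nonpositive slack and `s`
    -- nonnegative slack. So both are tight, and row `i` of `s` vanishes outside column `l`.
    γ : Fin n → ℚ
    γ x = 𝟙 (l ∈? G x)
    e-slack : ∀ x y → e x y * (γ x - unit l y) ≤ 0ℚ
    e-slack x y with l ∈? G x
    ... | yes _ with l Fin.≟ y
    ... | yes refl = ≤-reflexive (trans (cong (λ u → unit l l * (1ℚ - u)) (unit-self l)) (ℚ.*-zeroʳ (unit l l)))
    ... | no l≢y  = ≤-reflexive (trans (cong (_* (1ℚ - unit l y)) (unit-other l≢y)) (ℚ.*-zeroˡ (1ℚ - unit l y)))
    e-slack x y | no _ = ≤0⇒*≤0 (nonneg (strict⇒on gS) x y) (neg (0≤unit l y))
      where
      neg : ∀ {u} → 0ℚ ≤ u → 0ℚ - u ≤ 0ℚ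
      neg {u} h = ≤-trans (≤-reflexive (ℚ.+-identityˡ (- u))) (ℚ.neg-antimono-≤ h)
    unit≤1 : ∀ y → unit l y ≤ 1ℚ
    unit≤1 y = ≤-trans (term≤sum (0≤unit l) y) (≤-reflexive (sum-unit l))
    go : (∃ λ s → On A s × Stochastic s × (∀ k → colSum e k ≡ colSum s k)) → l ∈ A i
    go (s , on , st , eq) with l ∈? A i
    ... | yes l∈A = l∈A
    ... | no  l∉A = contradiction (trans (sym (st i)) (trans (sum-cong s≡0) (sum-0 d))) ℚ.1≢0
      where
      s-slack : ∀ x y → 0ℚ ≤ s x y * (γ x - unit l y)
      s-slack x y with l ∈? G x
      ... | yes _ = 0≤* (nonneg on x y) (≤⇒0≤- (unit≤1 y))
      ... | no l∉ with l Fin.≟ y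
      ... | yes refl = ≤-reflexive (sym (trans (cong (_* (0ℚ - unit l l)) (off on x l λ l∈ → l∉ (A⊑G x l∈))) (ℚ.*-zeroˡ (0ℚ - unit l l))))
      ... | no l≢y  = ≤-reflexive (sym (trans (cong (λ u → s x y * (0ℚ - u)) (unit-other l≢y)) (ℚ.*-zeroʳ (s x y))))
      s-tight : ∀ y → s i y * (γ i - unit l y) ≡ 0ℚ
      s-tight = proj₁ (complementary-slackness γ (unit l)
        ((λ x → trans (st x) (sym (e-st x))) , (λ y → sym (eq y))) s-slack e-slack) i
      s≡0 : ∀ y → s i y ≡ 0ℚ
      s≡0 y with l Fin.≟ y
      ... | yes refl = off on i l l∉A
      ... | no l≢y  = trans (sym (ℚ.*-identityʳ (s i y))) (trans (cong₂ (λ u v → s i y * (u - v))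
              (sym (𝟙-yes (l ∈? G i) l∈)) (sym (unit-other l≢y))) (s-tight y))

  record Face (A D : CellType n d) (c : Point d) : Set where
    constructor _,_
    field
      maximal : ∀ i {l} → l ∈ A i → ∀ {k} → k ∈ D i → c k ≤ c l
      attains : ∀ i {l} → l ∈ D i → (∀ {k} → k ∈ D i → c k ≤ c l) → l ∈ A i

  open Face public

  face-rank : ∀ {A D c} → Face A D c → Face A D (rank c)
  face-rank {c = c} (m , a) = (λ i l∈ k∈ → rank-mono c (m i l∈ k∈)) , λ i l∈ h → a i l∈ λ {k} k∈ → ℚ.≮⇒≥ λ cl<ck →
    <⇒≱ (0<-⇒< (ℚ.<-≤-trans 0<1 (rank-gap c cl<ck))) (h k∈)

  -- Moving the whole weight `a i k` from column `k` to column `l` stays in the cell of `D` and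
  -- changes the value of `c` by `a i k * (c l - c k)`, which cannot be positive at a maximum.
  maximizer⇒maximal : ∀ {A D a} c → Strict A a → Stochastic a → A ⊑ D →
    (∀ y → cell D y → dot c y ≤ dot c (colSum a)) → ∀ i {k l} → k ∈ A i → l ∈ D i → c l ≤ c k
  maximizer⇒maximal {A} {D} {a} c aS a1 A⊑D max i {k} {l} k∈ l∈ with w , 0<w , wa≡1 ← recip (pos aS i k k∈) =
    0≤-⇒≤ (ℚ.*-cancelˡ-≤-pos (a i k) {{positive (pos aS i k k∈)}}
      (≤-trans (≤-reflexive (ℚ.*-zeroʳ (a i k))) (≤-trans (≤⇒0≤- (max _ (on⇒cell e-on e-st)))
        (≤-reflexive (trans (cong (λ u → dot c (colSum a) - u) e-dot) (cancel (dot c (colSum a)) (a i k) (c l) (c k)))))))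
    where
    e : Mat n d
    e = a i k ⊙ (w ⊙ a ⊕ move i k l)
    e-on : On D e
    e-on = on-⊙ (<⇒≤ (pos aS i k k∈)) (on-move (on-mono A⊑D (strict⇒on aS)) l∈ 0<w wa≡1)
    e-st : Stochastic e
    e-st x = trans (sum-* (a i k) ((w ⊙ a ⊕ move i k l) x)) (trans (cong (a i k *_) (trans (sum-+ (λ y → w * a x y) (move i k l x))
      (trans (cong₂ _+_ (trans (sum-* w (a x)) (cong (w *_) (a1 x))) (rowSum-move i k l x)) (simp w))))
      (trans (ℚ.*-comm (a i k) w) wa≡1))
      where
      simp : ∀ w → w * 1ℚ + 0ℚ ≡ w
      simp = solve-∀ ℚring
    e-col : ∀ y → colSum e y ≡ colSum a y + a i k * (unit l y - unit k y)
    e-col y = trans (sum-* (a i k) (λ x → (w ⊙ a ⊕ move i k l) x y)) (trans (cong (a i k *_) (trans (sum-+ (λ x → w * a x y) (λ x → move i k l x y))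
      (cong₂ _+_ (sum-* w (λ x → a x y)) (colSum-move i k l y)))) (trans (expand (a i k) w (colSum a y) (unit l y - unit k y))
      (cong (_+ a i k * (unit l y - unit k y)) (trans (cong (_* colSum a y) wa≡1) (ℚ.*-identityˡ (colSum a y))))))
      where
      expand : ∀ δ w x u → δ * (w * x + u) ≡ w * δ * x + δ * u
      expand = solve-∀ ℚring
    e-dot : dot c (colSum e) ≡ dot c (colSum a) + a i k * (c l - c k)
    e-dot = begin
      dot c (colSum e) ≡⟨ sum-cong (λ y → trans (cong (c y *_) (e-col y)) (expand (c y) (colSum a y) (a i k) (unit l y) (unit k y))) ⟩
      sumFin (λ y → c y * colSum a y + (a i k * (unit l y * c y) + - a i k * (unit k y * c y)))
        ≡⟨ trans (sum-+ (λ y → c y * colSum a y) _) (cong (dot c (colSum a) +_) (trans (sum-+ (λ y → a i k * (unit l y * c y)) _)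
             (cong₂ _+_ (trans (sum-* (a i k) (λ y → unit l y * c y)) (cong (a i k *_) (dot-unit l c)))
                        (trans (sum-* (- a i k) (λ y → unit k y * c y)) (cong (- a i k *_) (dot-unit k c)))))) ⟩
      dot c (colSum a) + (a i k * c l + - a i k * c k) ≡⟨ cong (dot c (colSum a) +_) (collect (a i k) (c l) (c k)) ⟩
      dot c (colSum a) + a i k * (c l - c k) ∎
      where
      open ≡-Reasoning
      expand : ∀ c x δ u v → c * (x + δ * (u - v)) ≡ c * x + (δ * (u * c) + - δ * (v * c))
      expand = solve-∀ ℚring
      collect : ∀ δ u v → δ * u + - δ * v ≡ δ * (u - v)
      collect = solve-∀ ℚring
    cancel : ∀ x δ u v → x - (x + δ * (u - v)) ≡ δ * (v - u)
    cancel = solve-∀ ℚring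

sum-1 : ∀ m → sumFin {m} (λ _ → 1ℚ) ≡ (ℤ.+ m) / 1
sum-1 zero    = refl
sum-1 (suc m) = trans (cong (1ℚ +_) (sum-1 m)) (ℚ.toℚᵘ-injective (begin
  toℚᵘ (1ℚ + fromℚᵘ (mkℚᵘ (ℤ.+ m) 0))             ≈⟨ ℚ.toℚᵘ-homo-+ 1ℚ (fromℚᵘ (mkℚᵘ (ℤ.+ m) 0)) ⟩
  toℚᵘ 1ℚ ℚᵘ.+ toℚᵘ (fromℚᵘ (mkℚᵘ (ℤ.+ m) 0))     ≈⟨ ℚᵘ.+-congʳ (toℚᵘ 1ℚ) (ℚ.toℚᵘ-fromℚᵘ (mkℚᵘ (ℤ.+ m) 0)) ⟩
  toℚᵘ 1ℚ ℚᵘ.+ mkℚᵘ (ℤ.+ m) 0                     ≈⟨ *≡* (cong (λ k → (ℤ.+ 1 ℤ.+ k) ℤ.* ℤ.+ 1) (ℤ.*-identityʳ (ℤ.+ m))) ⟩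
  mkℚᵘ (ℤ.+ suc m) 0                              ≈⟨ ℚᵘ.≃-sym (ℚ.toℚᵘ-fromℚᵘ (mkℚᵘ (ℤ.+ suc m) 0)) ⟩
  toℚᵘ (fromℚᵘ (mkℚᵘ (ℤ.+ suc m) 0))              ∎))
  where open ℚᵘ.≃-Reasoning

-- Augmenting paths

module _ {n d : ℕ} where

  -- The residual digraph of `r` in `D`: weight present in column `a` of some row can be moved to
  -- column `b` within `D`.
  Flows : CellType n d → Mat n d → Fin d → Fin d → Set
  Flows D r a b = ∃ λ i → 0ℚ < r i a × b ∈ D i

  flows? : ∀ D r a b → Dec (Flows D r a b)
  flows? D r a b = any? λ i → 0ℚ <? r i a ×-dec b ∈? D i

  -- Each arc is a move in its own row, paid for by a multiple of `r`. Relocated to row `i` by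
  -- `move-~`, the moves telescope.
  augment : ∀ {D r} → On D r → ∀ i {k l} → Star (Flows D r) k l →
            ∃ λ c → 0ℚ ≤ c × InCone D (c ⊙ r ⊕ move i k l)
  augment {D} {r} on i {k} ε = 0ℚ , ≤-refl , (λ _ _ → 0ℚ) , ((λ _ _ → ≤-refl) , (λ _ _ _ → refl)) ,
    ~-pointwise λ x y → still (r x y) (unit i x) (unit k y)
    where
    still : ∀ r u v → 0ℚ ≡ 0ℚ * r + u * (v - v)
    still = solve-∀ ℚring
  augment {D} {r} on i {k} {l} (_◅_ {j = b} (x , 0<r , b∈) path)
    with c , 0≤c , s , s-on , s~ ← augment on i path
    with c′ , 0<c′ , c′r≡1 ← recip 0<r =
    c + c′ , 0≤+ 0≤c (<⇒≤ 0<c′) , s ⊕ (c′ ⊙ r ⊕ move x k b) , on-⊕ s-on (on-move on b∈ 0<c′ c′r≡1) ,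
    ~-trans (~-⊕ s~ (~-⊕ {r = c′ ⊙ r} ~-refl (move-~ x i k b)))
      (~-pointwise λ x y → telescope c c′ (r x y) (unit i x) (unit k y) (unit b y) (unit l y))
    where
    telescope : ∀ c c′ r u k b l → c * r + u * (l - b) + (c′ * r + u * (b - k)) ≡ (c + c′) * r + u * (l - k)
    telescope = solve-∀ ℚring

  rows-pos-~ : ∀ {r s : Mat n d} → r ~ s → (∀ i → 0ℚ < rowSum s i) → ∀ i → 0ℚ < rowSum r i
  rows-pos-~ r~s h i = subst (0ℚ <_) (sym (rows r~s i)) (h i)

𝟙≡1⇒ : ∀ {P : Set} (p? : Dec P) → 𝟙 p? ≡ 1ℚ → P
𝟙≡1⇒ (yes p) _  = p
𝟙≡1⇒ (no _)  eq = contradiction (sym eq) ℚ.1≢0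

upper-bound : ∀ {m} (f : Fin m → ℚ) → ∃ λ t → ∀ i → f i < t
upper-bound {zero}  f = 0ℚ , λ ()
upper-bound {suc m} f with t , h ← upper-bound (λ i → f (suc i)) =
  (1ℚ + f zero) ⊔ t , λ
    { zero    → ℚ.<-≤-trans (0<-⇒< (subst (0ℚ <_) (one (f zero)) 0<1)) (ℚ.p≤p⊔q (1ℚ + f zero) t)
    ; (suc i) → ℚ.<-≤-trans (h i) (ℚ.p≤q⊔p (1ℚ + f zero) t) }
  where
  one : ∀ x → 1ℚ ≡ 1ℚ + x - x
  one = solve-∀ ℚring

-- Matrices with a single edge, and links between columns

module _ {n d : ℕ} where

  edge : Fin n → Fin d → Mat n d
  edge i k x y = unit i x * unit k y

  rowSum-edge : ∀ i k x → rowSum (edge i k) x ≡ unit i x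
  rowSum-edge i k x = trans (sum-* (unit i x) (unit k)) (trans (cong (unit i x *_) (sum-unit k)) (ℚ.*-identityʳ (unit i x)))

  colSum-edge : ∀ i k y → colSum (edge i k) y ≡ unit k y
  colSum-edge i k y = trans (sum-cong λ x → ℚ.*-comm (unit i x) (unit k y))
    (trans (sum-* (unit k y) (unit i)) (trans (cong (unit k y *_) (sum-unit i)) (ℚ.*-identityʳ (unit k y))))

  edge-self : ∀ i k → edge i k i k ≡ 1ℚ
  edge-self i k = cong₂ _*_ (unit-self i) (unit-self k)

  edge-0or1 : ∀ i k x y → edge i k x y ≡ 0ℚ ⊎ (i ≡ x × k ≡ y)
  edge-0or1 i k x y with i Fin.≟ x | k Fin.≟ y
  ... | yes i≡x | yes k≡y = inj₂ (i≡x , k≡y)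
  ... | no i≢x  | _       = inj₁ (trans (cong (_* unit k y) (unit-other i≢x)) (ℚ.*-zeroˡ (unit k y)))
  ... | yes _   | no k≢y  = inj₁ (trans (cong (unit i x *_) (unit-other k≢y)) (ℚ.*-zeroʳ (unit i x)))

  edge-on : ∀ {D : CellType n d} {i k} → k ∈ D i → On D (edge i k)
  edge-on {D} {i} {k} k∈ = (λ x y → 0≤* (0≤unit i x) (0≤unit k y)) , oo
    where
    oo : ∀ x y → y ∉ D x → edge i k x y ≡ 0ℚ
    oo x y y∉ with edge-0or1 i k x y
    ... | inj₁ e≡0 = e≡0
    ... | inj₂ (refl , refl) = contradiction k∈ y∉

  Integral-⊕edge : ∀ {p : Mat n d} i k → (∀ x y → 0ℚ ≤ p x y) → (∀ x y → p x y ≡ 0ℚ ⊎ 1ℚ ≤ p x y) →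
                   ∀ x y → (edge i k ⊕ p) x y ≡ 0ℚ ⊎ 1ℚ ≤ (edge i k ⊕ p) x y
  Integral-⊕edge {p} i k 0≤p int x y with edge-0or1 i k x y
  ... | inj₂ (refl , refl) = inj₂ (≤-trans (≤-reflexive (sym (trans (ℚ.+-identityʳ _) (edge-self i k)))) (ℚ.+-monoʳ-≤ (edge i k i k) (0≤p i k)))
  ... | inj₁ e≡0 = [ (λ p≡0 → inj₁ (trans (cong₂ _+_ e≡0 p≡0) (ℚ.+-identityˡ 0ℚ))) ,
                     (λ 1≤p → inj₂ (≤-trans 1≤p (≤-reflexive (sym (trans (cong (_+ p x y) e≡0) (ℚ.+-identityˡ (p x y))))))) ]′ (int x y)

  Link : CellType n d → CellType n d → Fin d → Fin d → Set
  Link D B k l = ∃ λ i → k ∈ D i × l ∈ B i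

  link? : ∀ D B k l → Dec (Link D B k l)
  link? D B k l = any? λ i → k ∈? D i ×-dec l ∈? B i

-- Inclusion of cell types and faces of cells

module Subdivision {n d : ℕ} (S : MixedSubdivision n d) where
  open MixedSubdivision S public

  bary : ∀ {A} → IsCell A → Mat n d
  bary {A} cA = proj₁ (barycenter A (nonempty A cA))

  bary-strict : ∀ {A} (cA : IsCell A) → Strict A (bary cA)
  bary-strict {A} cA = proj₁ (proj₂ (barycenter A (nonempty A cA)))

  bary-stochastic : ∀ {A} (cA : IsCell A) → Stochastic (bary cA)
  bary-stochastic {A} cA = proj₂ (proj₂ (barycenter A (nonempty A cA)))

  module _ {A D : CellType n d} (cA : IsCell A) (cD : IsCell D) where
    private
      a = bary cA
      x = colSum a
      x∈A : cell A x
      x∈A = on⇒cell (strict⇒on (bary-strict cA)) (bary-stochastic cA)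

    -- The common region of the two cells is a face of `A` through a relatively interior point, so
    -- its functional is constant on `A` and the face is all of `A`. The mixed condition then places
    -- `A` inside the cell of `A ∩ D`.
    bary∈⇒⊑ : InCone D a → A ⊑ D
    bary∈⇒⊑ h i {k} k∈ with meetFaceˡ A D cA cD
    ... | inj₁ empty = contradiction (x∈A , inCone⇒cell (bary-stochastic cA) h) (empty x)
    ... | inj₂ (c , iff) = proj₂ (x∈p∩q⁻ (A i) (D i) (⊆-cell⇒⊑ (nonempty A cA) (λ i l∈ → proj₁ (x∈p∩q⁻ (A i) (D i) l∈)) sub i k∈))
      where
      max : ∀ y → cell A y → dot c y ≤ dot c x
      max = proj₂ (Equivalence.to (iff x) (x∈A , inCone⇒cell (bary-stochastic cA) h))
      γ : Fin n → ℚ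
      γ i = c (proj₁ (nonempty A cA i))
      level : ∀ i k → k ∈ A i → c k ≡ γ i
      level i k k∈ = ℚ.≤-antisym
        (maximizer⇒maximal c (bary-strict cA) (bary-stochastic cA) (λ _ k∈ → k∈) max i (proj₂ (nonempty A cA i)) k∈)
        (maximizer⇒maximal c (bary-strict cA) (bary-stochastic cA) (λ _ k∈ → k∈) max i k∈ (proj₂ (nonempty A cA i)))
      dot≡ : ∀ y → cell A y → dot c y ≡ sumFin λ i → γ i * 1ℚ
      dot≡ y hy with r , on , st , eq ← cell⇒on hy =
        trans (sum-cong λ k → cong (c k *_) (eq k)) (trans (dot-on c γ on level) (sum-cong λ i → cong (γ i *_) (st i)))
      sub : ∀ y → cell A y → cell (meetType A D) y
      sub y hy = Equivalence.to (meetMixed A D cA cD y) (Equivalence.from (iff y)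
        (hy , λ y′ hy′ → ≤-reflexive (trans (dot≡ y′ hy′) (sym (dot≡ y hy)))))

    -- The functional cutting out the common region as a face of `D` is maximal at the barycenter of
    -- `A`, hence on all of `A i` in every row. Conversely the face `G` of `D` selected by it lies
    -- in the region of `A`, and regions determine types.
    ⊑⇒face : A ⊑ D → ∃ (Face A D)
    ⊑⇒face A⊑D with meetFaceʳ A D cA cD
    ... | inj₁ empty = contradiction (x∈A , on⇒cell (on-mono A⊑D (strict⇒on (bary-strict cA))) (bary-stochastic cA)) (empty x)
    ... | inj₂ (c , iff) = c , maxi , λ i l∈ h → G⊑A i (Equivalence.from (char i _) (l∈ , λ k → h))
      where
      G = proj₁ (faceClosed D cD c)
      cG = proj₁ (proj₂ (faceClosed D cD c))
      char = proj₂ (proj₂ (faceClosed D cD c))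
      max : ∀ y → cell D y → dot c y ≤ dot c x
      max = proj₂ (Equivalence.to (iff x) (x∈A , on⇒cell (on-mono A⊑D (strict⇒on (bary-strict cA))) (bary-stochastic cA)))
      maxi : ∀ i {l} → l ∈ A i → ∀ {k} → k ∈ D i → c k ≤ c l
      maxi i l∈ k∈ = maximizer⇒maximal c (bary-strict cA) (bary-stochastic cA) A⊑D max i l∈ k∈
      γ : Fin n → ℚ
      γ i = c (proj₁ (nonempty A cA i))
      below : ∀ i k → k ∈ D i → c k ≤ γ i
      below i k k∈ = maxi i (proj₂ (nonempty A cA i)) k∈
      level : ∀ i k → k ∈ G i → c k ≡ γ i
      level i k k∈ with k∈D , h ← Equivalence.to (char i k) k∈ =
        ℚ.≤-antisym (below i k k∈D) (h _ (A⊑D i (proj₂ (nonempty A cA i))))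
      sub : ∀ y → cell G y → cell A y
      sub y hy with r , on , st , eq ← cell⇒on hy = proj₁ (Equivalence.from (iff y) (y∈D , top))
        where
        y∈D : cell D y
        y∈D = r , (λ i → nonneg on i , st i , λ k k∉ → off on i k λ k∈ → k∉ (proj₁ (Equivalence.to (char i k) k∈))) , eq
        top : ∀ y′ → cell D y′ → dot c y′ ≤ dot c y
        top y′ hy′ with r′ , on′ , st′ , eq′ ← cell⇒on hy′ = ≤-trans
          (≤-trans (≤-reflexive (sum-cong λ k → cong (c k *_) (eq′ k))) (dot-on-≤ c γ on′ below))
          (≤-reflexive (trans (sum-cong λ i → cong (γ i *_) (trans (st′ i) (sym (st i))))
            (trans (sym (dot-on c γ on level)) (sum-cong λ k → cong (c k *_) (sym (eq k))))))
      G⊑A : G ⊑ A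
      G⊑A = ⊆-cell⇒⊑ (nonempty G cG)
        (λ i {l} l∈ → Equivalence.from (char i l) (A⊑D i l∈ , λ k k∈ → maxi i l∈ k∈)) sub

  -- Carriers: the cell containing given margins in its relative interior

  record Refines (D : CellType n d) (r : Mat n d) (D′ : CellType n d) (r′ : Mat n d) : Set where
    field
      isCell : IsCell D′
      below  : D′ ⊑ D
      supp   : On D′ r′
      same   : r′ ~ r
      grows  : ∀ i k → 0ℚ < r i k → 0ℚ < r′ i k

  refines-refl : ∀ {D r} → IsCell D → On D r → Refines D r D r
  refines-refl cD on = record { isCell = cD ; below = λ _ k∈ → k∈ ; supp = on ; same = ~-refl ; grows = λ _ _ h → h }

  -- If the edge (i, k) lies on a cycle of the residual digraph, the cycle is
  -- used to put weight on it; otherwise the columns reachable from k cut out a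
  -- face of D that avoids the edge and still supports r.
  settle : ∀ {D r} → IsCell D → On D r → (∀ i → 0ℚ < rowSum r i) → ∀ i k →
           Σ (CellType n d) λ D′ → Σ (Mat n d) λ r′ → Refines D r D′ r′ × (k ∉ D′ i ⊎ 0ℚ < r′ i k)
  settle {D} {r} cD on rows>0 i k with k ∈? D i | 0ℚ <? r i k
  ... | no k∉ | _       = D , r , refines-refl cD on , inj₁ k∉
  ... | yes _ | yes 0<r = D , r , refines-refl cD on , inj₂ 0<r
  ... | yes k∈ | no r≯0 with any? (λ l → l ∈? Reach.reach (Flows D r) (flows? D r) k ×-dec 0ℚ <? r i l)
  ... | yes (l , l∈ , 0<ril)
      with c , 0≤c , s , s-on , s~ ← augment on i (Reach.reach⇒star (Flows D r) (flows? D r) k l∈)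
      with c′ , 0<c′ , c′r≡1 ← recip 0<ril
      -- The path from `k` to `l` is closed by a move from `l` back to `k` in row `i`. The moves
      -- cancel in the margins, leaving `1 + (c + c′)` copies of `r`, which `e` scales back to one.
      with e , 0<e , e≡ ← recip (0<+ˡ 0<1 (0≤+ 0≤c (<⇒≤ 0<c′))) =
      D , e ⊙ (r ⊕ w) , record
        { isCell = cD ; below = λ _ k∈ → k∈ ; supp = on-⊙ (<⇒≤ 0<e) (on-⊕ on w-on)
        ; same = ~-trans (~-⊙ e (~-⊕ {r = r} ~-refl (~-⊕ s~ (~-refl {r = c′ ⊙ r ⊕ move i l k}))))
            (~-pointwise λ x y → trans (collect e c c′ (r x y) (unit i x) (unit k y) (unit l y))
              (trans (cong (_* r x y) e≡) (ℚ.*-identityˡ (r x y))))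
        ; grows = λ x y h → 0<* 0<e (0<+ˡ h (nonneg w-on x y)) } ,
      inj₂ (0<* 0<e (0<+ʳ (nonneg on i k) (0<+ʳ (nonneg s-on i k)
        (0<+ʳ (0≤* (<⇒≤ 0<c′) (nonneg on i k)) (subst (0ℚ <_) (sym move≡1) 0<1)))))
    where
    w : Mat n d
    w = s ⊕ (c′ ⊙ r ⊕ move i l k)
    w-on : On D w
    w-on = on-⊕ s-on (on-move on k∈ 0<c′ c′r≡1)
    move≡1 : move i l k i k ≡ 1ℚ
    move≡1 = trans (cong₂ (λ u v → u * (v - unit l k)) (unit-self i) (unit-self k))
      (cong (λ u → 1ℚ * (1ℚ - u)) (unit-other {k = l} {k} λ { refl → r≯0 0<ril }))
    collect : ∀ e c c′ r u k l → e * (r + (c * r + u * (l - k) + (c′ * r + u * (k - l)))) ≡ e * (1ℚ + (c + c′)) * r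
    collect = solve-∀ ℚring
  -- The functional is -1 on the columns reachable from `k` and 0 elsewhere. A positive entry of `r`
  -- in a reachable column makes its whole row of `D` reachable, so `r` stays supported. Row `i` has
  -- weight in an unreachable column, so `k` is not maximal there.
  ... | no none with D′ , cD′ , char ← faceClosed D cD (λ y → - 𝟙 (y ∈? Reach.reach (Flows D r) (flows? D r) k)) =
      D′ , r , record
        { isCell = cD′ ; below = λ x {y} y∈ → proj₁ (Equivalence.to (char x y) y∈)
        ; supp = nonneg on , supported ; same = ~-refl ; grows = λ _ _ h → h } ,
      inj₁ excluded
    where
    open Reach (Flows D r) (flows? D r)
    c : Point d
    c y = - 𝟙 (y ∈? reach k)
    c≤0 : ∀ y → c y ≤ 0ℚ
    c≤0 y = ℚ.neg-antimono-≤ (0≤𝟙 (y ∈? reach k))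
    supported : ∀ x y → y ∉ D′ x → r x y ≡ 0ℚ
    supported x y y∉ with 0ℚ <? r x y
    ... | no r≯0  = ℚ.≤-antisym (ℚ.≮⇒≥ r≯0) (nonneg on x y)
    ... | yes 0<r = contradiction (Equivalence.from (char x y) (pos⇒∈ on 0<r , top)) y∉
      where
      top : ∀ z → z ∈ D x → c z ≤ c y
      top z z∈ with y ∈? reach k
      ... | yes y∈ = ≤-reflexive (cong -_ (𝟙-yes (z ∈? reach k) (reach-closed k y∈ (x , 0<r , z∈))))
      ... | no  _  = c≤0 z
    excluded : k ∉ D′ i
    excluded k∈′ with l , 0<ril ← ∃-positive-term (r i) (rows>0 i) =
      <⇒≱ (ℚ.neg-antimono-< 0<1) (subst₂ _≤_ (cong -_ (𝟙-no (l ∈? reach k) λ l∈ → none (l , l∈ , 0<ril)))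
        (cong -_ (𝟙-yes (k ∈? reach k) (self∈reach k)))
        (proj₂ (Equivalence.to (char i k) k∈′) l (pos⇒∈ on 0<ril)))

  -- Cells only shrink and supports only grow, so a settled edge stays settled.
  settle-all : ∀ (L : List (Fin n × Fin d)) {D r} → IsCell D → On D r → (∀ i → 0ℚ < rowSum r i) →
    Σ (CellType n d) λ D′ → Σ (Mat n d) λ r′ → Refines D r D′ r′ × (∀ {i k} → (i , k) ∈ˡ L → k ∉ D′ i ⊎ 0ℚ < r′ i k)
  settle-all [] {D} {r} cD on _ = D , r , refines-refl cD on , λ ()
  settle-all ((i , k) ∷ L) {D} {r} cD on rows>0
    with D₁ , r₁ , ref₁ , done₁ ← settle cD on rows>0 i k
    with D₂ , r₂ , ref₂ , done₂ ← settle-all L (Refines.isCell ref₁) (Refines.supp ref₁) (rows-pos-~ (Refines.same ref₁) rows>0) =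
    D₂ , r₂ , record
      { isCell = ref₂ .isCell ; below = λ i k∈ → ref₁ .below i (ref₂ .below i k∈) ; supp = ref₂ .supp
      ; same = ~-trans (ref₂ .same) (ref₁ .same) ; grows = λ i k h → ref₂ .grows i k (ref₁ .grows i k h) } , done
    where
    open Refines
    done : ∀ {j l} → (j , l) ∈ˡ (i , k) ∷ L → l ∉ D₂ j ⊎ 0ℚ < r₂ j l
    done (there jl∈) = done₂ jl∈
    done (here refl) = [ (λ k∉ → inj₁ λ k∈ → k∉ (ref₂ .below i k∈)) , (λ 0<r → inj₂ (ref₂ .grows i k 0<r)) ]′ done₁

  -- Once every edge is settled, each edge that remains in the cell carries positive weight.
  carrier : ∀ {D r} → IsCell D → On D r → (∀ i → 0ℚ < rowSum r i) →
            Σ (CellType n d) λ F → Σ (Mat n d) λ f → IsCell F × F ⊑ D × Strict F f × f ~ r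
  carrier {D} {r} cD on rows>0
    with F , f , ref , done ← settle-all (cartesianProduct (allFin n) (allFin d)) cD on rows>0 =
    F , f , isCell ref , below ref , ((λ i k k∈ → [ (λ k∉ → contradiction k∈ k∉) , (λ 0<f → 0<f) ]′
      (done (∈-cartesianProduct⁺ (∈-allFin i) (∈-allFin k)))) , off (Refines.supp ref)) , same ref
    where open Refines

  -- Small moves out of a cell in a given direction

  Extension : CellType n d → Mat n d → Mat n d → Set
  Extension A p q = Σ (CellType n d) λ D → Σ ℚ λ η → Σ (Mat n d) λ r →
    IsCell D × A ⊑ D × 0ℚ < η × Strict D r × r ~ p ⊕ η ⊙ q

  module _ {A : CellType n d} {p q : Mat n d} (cA : IsCell A) (pS : Strict A p) (0≤q : ∀ i k → 0ℚ ≤ q i k) where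
    private
      a Q : Mat n d
      a = bary cA
      -- The correction by `a` keeps every row sum of `M δ` equal to 1, so that `covers` applies to
      -- its column sums.
      Q = q ⊕ (λ i k → - (rowSum q i * a i k))

      M a′ : ℚ → Mat n d
      M δ = a ⊕ δ ⊙ Q
      a′ δ i k = (1ℚ - δ * rowSum q i) * a i k

      a-on : On A a
      a-on = strict⇒on (bary-strict cA)

      M≡ : ∀ δ i k → M δ i k ≡ a′ δ i k + δ * q i k
      M≡ δ i k = expand (a i k) δ (q i k) (rowSum q i)
        where
        expand : ∀ a δ q s → a + δ * (q + - (s * a)) ≡ (1ℚ - δ * s) * a + δ * q
        expand = solve-∀ ℚring

      M-stochastic : ∀ δ → Stochastic (M δ)
      M-stochastic δ i = trans (sum-cong (M≡ δ i)) (trans (sum-+ (a′ δ i) _) (trans (cong₂ _+_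
        (trans (sum-* (1ℚ - δ * rowSum q i) (a i)) (cong ((1ℚ - δ * rowSum q i) *_) (bary-stochastic cA i))) (sum-* δ (q i)))
        (cancel (δ * rowSum q i))))
        where
        cancel : ∀ x → (1ℚ - x) * 1ℚ + x ≡ 1ℚ
        cancel = solve-∀ ℚring

      near : ∀ δ → 0ℚ < δ → (∀ i → δ * rowSum q i ≤ 1ℚ) →
             Σ (CellType n d) λ F → Σ (Mat n d) λ f → IsCell F × Strict F f × f ~ M δ
      near δ 0<δ small = carried (covers (colSum (M δ)) ((λ k → sum-nonneg λ i → M≥0 i k) , total))
        where
        M≥0 : ∀ i k → 0ℚ ≤ M δ i k
        M≥0 i k = subst (0ℚ ≤_) (sym (M≡ δ i k)) (0≤+ (0≤* (≤⇒0≤- (small i)) (nonneg a-on i k)) (0≤* (<⇒≤ 0<δ) (0≤q i k)))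
        total : sumFin (colSum (M δ)) ≡ (ℤ.+ n) / 1
        total = trans (sym (sum-swap (M δ))) (trans (sum-cong (M-stochastic δ)) (sum-1 n))
        carried : (Σ (CellType n d) λ C → IsCell C × cell C (colSum (M δ))) →
                  Σ (CellType n d) λ F → Σ (Mat n d) λ f → IsCell F × Strict F f × f ~ M δ
        carried (C , cC , M∈C) =
          let s , s-on , s-st , s-col = cell⇒on M∈C
              F , f , cF , _ , fS , f~s = carrier cC s-on (λ i → subst (0ℚ <_) (sym (s-st i)) 0<1)
          in F , f , cF , fS , ~-trans f~s ((λ i → trans (s-st i) (sym (M-stochastic δ i))) , (λ k → sym (s-col k)))

      -- Transplants the move from the barycenter to `p`: as `η * a ≤ p`, the part `η ⊙ a′ δ` can be
      -- removed from `p`, and adding `η ⊙ f` in its place yields the margins of `p ⊕ (η * δ) ⊙ q`.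
      rescale : ∀ {F f δ η} → IsCell F → A ⊑ F → Strict F f → 0ℚ < δ → f ~ M δ →
                0ℚ < η → (∀ i k → η * a i k ≤ p i k) → Extension A p q
      rescale {F} {f} {δ} {η} cF A⊑F fS 0<δ f~M 0<η ηa≤p =
        F , η * δ , (p ⊕ (- η) ⊙ a′ δ) ⊕ η ⊙ f , cF , A⊑F , 0<* 0<η 0<δ , strict ,
        ~-trans (~-⊕ {r = p ⊕ (- η) ⊙ a′ δ} ~-refl (~-⊙ η f~M)) (~-pointwise λ i k →
          trans (cong (λ u → p i k + - η * a′ δ i k + η * u) (M≡ δ i k)) (collect (p i k) η (a′ δ i k) δ (q i k)))
        where
        collect : ∀ p η a δ q → p + - η * a + η * (a + δ * q) ≡ p + η * δ * q
        collect = solve-∀ ℚring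
        split : ∀ p η δ s a → p + - η * ((1ℚ - δ * s) * a) ≡ p - η * a + η * (δ * s) * a
        split = solve-∀ ℚring
        base≥0 : ∀ i k → 0ℚ ≤ p i k + - η * a′ δ i k
        base≥0 i k = subst (0ℚ ≤_) (sym (split (p i k) η δ (rowSum q i) (a i k)))
          (0≤+ (≤⇒0≤- (ηa≤p i k)) (0≤* (0≤* (<⇒≤ 0<η) (0≤* (<⇒≤ 0<δ) (sum-nonneg (0≤q i)))) (nonneg a-on i k)))
        vanish : ∀ η x → 0ℚ + - η * (x * 0ℚ) + η * 0ℚ ≡ 0ℚ
        vanish = solve-∀ ℚring
        strict : Strict F ((p ⊕ (- η) ⊙ a′ δ) ⊕ η ⊙ f)
        strict = (λ i k k∈ → 0<+ʳ (base≥0 i k) (0<* 0<η (pos fS i k k∈))) , λ i k k∉ →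
          trans (cong₂ _+_ (cong₂ (λ u v → u + - η * ((1ℚ - δ * rowSum q i) * v))
              (off′ pS i k λ k∈ → k∉ (A⊑F i k∈)) (off a-on i k λ k∈ → k∉ (A⊑F i k∈)))
            (cong (η *_) (off′ fS i k k∉))) (vanish η (1ℚ - δ * rowSum q i))

      fits : ∀ i k → Small (λ η → η * a i k ≤ p i k)
      fits i k with k ∈? A i
      ... | yes k∈ = small-* (a i k) (nonneg a-on i k) (pos pS i k k∈)
      ... | no  k∉ = 1ℚ , 0<1 , λ {η} _ _ → ≤-reflexive (trans (cong (η *_) (off a-on i k k∉)) (trans (ℚ.*-zeroʳ η) (sym (off′ pS i k k∉))))

      -- No critical parameter lies in `(0, δ]`, so membership in the cone of `F` passes from `M δ`
      -- to `M 0`, which is the barycenter of `A`.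
      limit : ∀ {F f δ L} → IsCell F → Strict F f → f ~ M δ → (∀ D → ChangesOnlyAt L (λ t → InCone D (M t))) →
              (∀ {ρ} → ρ ∈ˡ L → Avoids ρ δ 0ℚ) → A ⊑ F
      limit {F} {f} cF fS f~M changes avoids =
        let r , r-on , r~ = changes F (f , strict⇒on fS , f~M) avoids in
        bary∈⇒⊑ cA cF (r , r-on , ~-trans r~ (~-pointwise λ i k → at0 (a i k) (Q i k)))
        where
        at0 : ∀ a q → a + 0ℚ * q ≡ a
        at0 = solve-∀ ℚring

      assemble : ∀ {L} → (∀ D → ChangesOnlyAt L (λ t → InCone D (M t))) →
        Small (λ δ → (∀ {ρ} → ρ ∈ˡ L → Avoids ρ δ 0ℚ) × (∀ i → δ * rowSum q i ≤ 1ℚ)) →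
        Small (λ η → ∀ i k → η * a i k ≤ p i k) → Extension A p q
      assemble {L} changes (δ , 0<δ , δ-ok) (η , 0<η , η-ok) = finish (near δ 0<δ (proj₂ (δ-ok 0<δ ≤-refl)))
        where
        finish : (Σ (CellType n d) λ F → Σ (Mat n d) λ f → IsCell F × Strict F f × f ~ M δ) → Extension A p q
        finish (F , f , cF , fS , f~M) =
          rescale {F} {f} {δ} {η} cF (limit {F} {f} {δ} {L} cF fS f~M changes (proj₁ (δ-ok 0<δ ≤-refl)))
            fS 0<δ f~M 0<η (η-ok 0<η ≤-refl)

    -- Here `δ` is small enough that `M δ` is nonnegative and no critical parameter intervenes, and
    -- `η` small enough that `η * a ≤ p`.
    extend : Extension A p q
    extend = assemble {proj₁ (cone-roots a Q)} (proj₂ (cone-roots a Q))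
      (small-× (small-avoids _) (small-∀ λ i → small-* (rowSum q i) (sum-nonneg (0≤q i)) 0<1))
      (small-∀ λ i → small-∀ λ k → fits i k)

  -- Walking along a segment of margins

  mix : Mat n d → Mat n d → ℚ → Mat n d
  mix u v t = u ⊕ t ⊙ (v ⊕ (- 1ℚ) ⊙ u)

  mix-convex : ∀ u v t i k → mix u v t i k ≡ (1ℚ - t) * u i k + t * v i k
  mix-convex u v t i k = expand (u i k) (v i k) t
    where
    expand : ∀ u v t → u + t * (v + - 1ℚ * u) ≡ (1ℚ - t) * u + t * v
    expand = solve-∀ ℚring

  -- The sum is `1 + η` times the point of the segment at the weighted average
  -- `(s + η * e) / (1 + η)`; the factor `κ` divides by `1 + η`.
  mix-between : ∀ {D u v r η s e} → On D r → 0ℚ < η → s < e → r ~ mix u v s ⊕ η ⊙ mix u v e →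
                ∃ λ t → s < t × t < e × InCone D (mix u v t)
  mix-between {D} {u} {v} {r} {η} {s} {e} on 0<η s<e r~ = average (recip (0<+ˡ 0<1 (<⇒≤ 0<η)))
    where
    lower : ∀ κ s η e → κ * (s + η * e) - κ * (1ℚ + η) * s ≡ κ * η * (e - s)
    lower = solve-∀ ℚring
    upper : ∀ κ s η e → κ * (1ℚ + η) * e - κ * (s + η * e) ≡ κ * (e - s)
    upper = solve-∀ ℚring
    blend : ∀ κ η u w s e → κ * (u + s * w + η * (u + e * w)) ≡ κ * (1ℚ + η) * u + κ * (s + η * e) * w
    blend = solve-∀ ℚring
    average : (∃ λ κ → 0ℚ < κ × κ * (1ℚ + η) ≡ 1ℚ) → ∃ λ t → s < t × t < e × InCone D (mix u v t)
    average (κ , 0<κ , κ[1+η]≡1) = κ * (s + η * e) ,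
      0<-⇒< (subst (0ℚ <_) (trans (sym (lower κ s η e)) (cong (λ x → κ * (s + η * e) - x) (one s))) (0<* (0<* 0<κ 0<η) (<⇒0<- s<e))) ,
      0<-⇒< (subst (0ℚ <_) (trans (sym (upper κ s η e)) (cong (_- κ * (s + η * e)) (one e))) (0<* 0<κ (<⇒0<- s<e))) ,
      κ ⊙ r , on-⊙ (<⇒≤ 0<κ) on , ~-trans (~-⊙ κ r~) (~-pointwise λ i k →
        trans (blend κ η (u i k) (v i k + - 1ℚ * u i k) s e) (cong (_+ κ * (s + η * e) * (v i k + - 1ℚ * u i k)) (one (u i k))))
      where
      one : ∀ x → κ * (1ℚ + η) * x ≡ x
      one x = trans (cong (_* x) κ[1+η]≡1) (ℚ.*-identityˡ x)

  -- Between two parameters at which membership in a cone changes, a cell met just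
  -- after the carrier of the first point reaches the second point.
  walk : ∀ {u v} → (∀ i k → 0ℚ ≤ u i k) → (∀ i k → 0ℚ ≤ v i k) → (∀ i → 0ℚ < rowSum u i) →
    (Good : CellType n d → Set) → (∀ {A D} → A ⊑ D → Good A → Good D) →
    (∀ {D} → IsCell D → InCone D v → Good D) →
    (∀ {F D f t} → IsCell F → IsCell D → F ⊑ D → Good D → Strict F f → 0ℚ ≤ t → t ≤ 1ℚ → f ~ mix u v t → Good F) →
    ∀ {D} → IsCell D → InCone D u → Good D
  walk {u} {v} 0≤u 0≤v rows>0 Good up end faces {D} cD (r , on , r~u)
    = backward-induction {G = G} {0ℚ} {1ℚ} L step ≤-refl 0<1 ≤-refl
      (λ cD (r , on , r~) → end cD (r , on , ~-trans r~ (~-pointwise λ i k → at1 (u i k) (v i k)))) cD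
      (r , on , ~-trans r~u (~-pointwise λ i k → at0 (u i k) (v i k)))
    where
    at0 : ∀ u v → u ≡ u + 0ℚ * (v + - 1ℚ * u)
    at0 = solve-∀ ℚring
    at1 : ∀ u v → u + 1ℚ * (v + - 1ℚ * u) ≡ v
    at1 = solve-∀ ℚring
    L = proj₁ (cone-roots u (v ⊕ (- 1ℚ) ⊙ u))
    changes = proj₂ (cone-roots u (v ⊕ (- 1ℚ) ⊙ u))
    G : ℚ → Set
    G t = ∀ {D} → IsCell D → InCone D (mix u v t) → Good D
    mix≥0 : ∀ {t} → 0ℚ ≤ t → t ≤ 1ℚ → ∀ i k → 0ℚ ≤ mix u v t i k
    mix≥0 {t} 0≤t t≤1 i k = subst (0ℚ ≤_) (sym (mix-convex u v t i k))
      (0≤+ (0≤* (≤⇒0≤- t≤1) (0≤u i k)) (0≤* 0≤t (0≤v i k)))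
    mix-rows : ∀ {t} → 0ℚ ≤ t → t < 1ℚ → ∀ i → 0ℚ < rowSum (mix u v t) i
    mix-rows {t} 0≤t t<1 i = subst (0ℚ <_) (sym (trans (sum-cong (mix-convex u v t i))
        (trans (sum-+ (λ k → (1ℚ - t) * u i k) _) (cong₂ _+_ (sum-* (1ℚ - t) (u i)) (sum-* t (v i))))))
      (0<+ˡ (0<* (<⇒0<- t<1) (rows>0 i)) (0≤* 0≤t (sum-nonneg (0≤v i))))
    step : ∀ {s e} → 0ℚ ≤ s → s < e → e ≤ 1ℚ → (∀ {ρ} → ρ ∈ˡ L → ¬ (s < ρ × ρ < e)) → G e → G s
    step {s} {e} 0≤s s<e e≤1 none good-e {D} cD (r , on , r~) =
      from-carrier (carrier cD on (rows-pos-~ r~ (mix-rows 0≤s (ℚ.<-≤-trans s<e e≤1))))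
      where
      from-carrier : (Σ (CellType n d) λ F → Σ (Mat n d) λ f → IsCell F × F ⊑ D × Strict F f × f ~ r) → Good D
      from-carrier (F , f , cF , F⊑D , fS , f~r) =
        from-extension (extend {F} {f} {mix u v e} cF fS (mix≥0 (≤-trans 0≤s (<⇒≤ s<e)) e≤1))
        where
        f~ : f ~ mix u v s
        f~ = ~-trans f~r r~
        from-extension : Extension F f (mix u v e) → Good D
        from-extension (D′ , η , r′ , cD′ , F⊑D′ , 0<η , r′S , r′~) =
          -- Goodness of `D′`, known from the parameter `e`, passes down to the carrier `F` of the
          -- point at `s` and from there up to `D`.
          up F⊑D (faces {F} {D′} {f} {s} cF cD′ F⊑D′
            (arrive (mix-between {D′} {u} {v} {r′} {η} {s} {e} (strict⇒on r′S) 0<η s<e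
              (~-trans r′~ (~-⊕ {r = f} {s = mix u v s} f~ (~-refl {r = η ⊙ mix u v e})))))
            fS 0≤s (≤-trans (<⇒≤ s<e) e≤1) f~)
          where
          arrive : (∃ λ t → s < t × t < e × InCone D′ (mix u v t)) → Good D′
          -- The open interval between `s` and `e` contains no critical parameter, and arriving at
          -- one in `e` is allowed.
          arrive (t , s<t , t<e , at-t) = good-e cD′ (changes D′ {t} {e} at-t λ ρ∈ →
            (λ (t≤ρ , ρ<e) → none ρ∈ (ℚ.<-≤-trans s<t t≤ρ , ρ<e)) ,
            (λ (e<ρ , ρ≤t) → ℚ.<-asym t<e (ℚ.<-≤-trans e<ρ ρ≤t)))

  -- Compatibility of supports under equal margins

  Integral : Mat n d → Set
  Integral p = ∀ i k → p i k ≡ 0ℚ ⊎ 1ℚ ≤ p i k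

  module Compatibility {A B : CellType n d} (cA : IsCell A) (cB : IsCell B) {p q : Mat n d}
    (p-on : On A p) (q-on : On B q) (p~q : p ~ q) (p-int : Integral p) where

    private
      a b : Mat n d
      a = bary cA
      b = bary cB
      a-on : On A a
      a-on = strict⇒on (bary-strict cA)
      b-on : On B b
      b-on = strict⇒on (bary-strict cB)
      -- N ⊙ p outweighs a stochastic matrix in every pairing with ranks, which lie in [0, K].
      K N : ℚ
      K = sumFin {d} (λ _ → 1ℚ)
      N = 1ℚ + K * sumFin {n} (λ _ → 1ℚ)
      0≤K : 0ℚ ≤ K
      0≤K = sum-nonneg {d} λ _ → <⇒≤ 0<1
      0≤N : 0ℚ ≤ N
      0≤N = 0≤+ (<⇒≤ 0<1) (0≤* 0≤K (sum-nonneg {n} λ _ → <⇒≤ 0<1))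

      aᴺ-on : On A (a ⊕ N ⊙ p)
      aᴺ-on = on-⊕ a-on (on-⊙ 0≤N p-on)

      bᴺ-on : On B (b ⊕ N ⊙ q)
      bᴺ-on = on-⊕ b-on (on-⊙ 0≤N q-on)

      rows>0 : ∀ {C : CellType n d} {c r : Mat n d} → (∀ i → rowSum c i ≡ 1ℚ) → On C (N ⊙ r) → ∀ i → 0ℚ < rowSum (c ⊕ N ⊙ r) i
      rows>0 {C} {c} {r} st on i = subst (0ℚ <_) (sym (sum-+ (c i) ((N ⊙ r) i)))
        (0<+ˡ (subst (0ℚ <_) (sym (st i)) 0<1) (sum-nonneg (nonneg on i)))

      level : ∀ {F} → IsCell F → Point d → Fin n → ℚ
      level {F} cF c i = c (proj₁ (nonempty F cF i))

      below-level : ∀ {F D c} (cF : IsCell F) → Face F D c → ∀ i k → k ∈ D i → c k ≤ level cF c i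
      below-level {F} cF face i k k∈ = maximal face i (proj₂ (nonempty F cF i)) k∈

      at-level : ∀ {F D c} (cF : IsCell F) → F ⊑ D → Face F D c → ∀ i k → k ∈ F i → c k ≡ level cF c i
      at-level {F} cF F⊑D face i k k∈ = ℚ.≤-antisym (below-level cF face i k (F⊑D i k∈)) (maximal face i k∈ (F⊑D i (proj₂ (nonempty F cF i))))

      level⇒∈ : ∀ {F D c} (cF : IsCell F) → Face F D c → ∀ i {k} → k ∈ D i → level cF c i ≤ c k → k ∈ F i
      level⇒∈ cF face i k∈ h = attains face i k∈ λ l∈ → ≤-trans (below-level cF face i _ l∈) h

    -- Walk from `a ⊕ N ⊙ p` to `a`, where the barycenter settles the claim. Every intermediate
    -- point has the margins of a matrix positive on all of `A`; when these lie in a face `F` of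
    -- `D`, the functional exposing `F` is tight on that matrix, so `A ⊑ F`.
    shifted∈⇒⊑ : ∀ {D} → IsCell D → InCone D (a ⊕ N ⊙ p) → A ⊑ D
    shifted∈⇒⊑ = walk (nonneg aᴺ-on) (nonneg a-on) (rows>0 {c = a} {p} (bary-stochastic cA) (on-⊙ 0≤N p-on))
      (A ⊑_) (λ A⊑D h i k∈ → A⊑D i (h i k∈)) (λ cD h → bary∈⇒⊑ cA cD h) faces
      where
      faces : ∀ {F D f t} → IsCell F → IsCell D → F ⊑ D → A ⊑ D → Strict F f → 0ℚ ≤ t → t ≤ 1ℚ → f ~ mix (a ⊕ N ⊙ p) a t → A ⊑ F
      faces {F} {D} {f} {t} cF cD F⊑D A⊑D fS 0≤t t≤1 f~ i {k} k∈ with c , face ← ⊑⇒face cF cD F⊑D =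
        level⇒∈ cF face i (A⊑D i k∈) (≤-reflexive (-≡0⇒≡ (0<*⇒≡0 (pos gS i k k∈)
          (proj₁ (complementary-slackness (level cF c) c g~f (on-slack c (level cF c) (on-mono A⊑D (strict⇒on gS)) (below-level cF face))
            (λ i k → ≤-reflexive (tight c (level cF c) (strict⇒on fS) (at-level cF F⊑D face) i k))) i k))))
        where
        g : Mat n d
        g = a ⊕ ((1ℚ - t) * N) ⊙ p
        gS : Strict A g
        gS = strict-⊕ (bary-strict cA) (on-⊙ (0≤* (≤⇒0≤- t≤1) 0≤N) p-on)
        g~f : g ~ f
        g~f = ~-trans (~-pointwise λ i k → expand (a i k) (p i k) t N) (~-sym f~)
          where
          expand : ∀ a p t N → a + (1ℚ - t) * N * p ≡ a + N * p + t * (a + - 1ℚ * (a + N * p))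
          expand = solve-∀ ℚring

    -- Walk from `b ⊕ N ⊙ q` to `a ⊕ N ⊙ p`. Since `p ~ q`, every intermediate point has the margins
    -- of `N ⊙ p ⊕ w` with `w` stochastic. If a face `F` of `D` missed an edge of `p`, the loss of
    -- `N ⊙ p` in the functional exposing `F` would exceed what `w` can compensate.
    support⊑ : ∀ i k → 0ℚ < p i k → k ∈ B i
    support⊑ = walk (nonneg bᴺ-on) (nonneg aᴺ-on) (rows>0 {c = b} {q} (bary-stochastic cB) (on-⊙ 0≤N q-on))
      (λ D → ∀ i k → 0ℚ < p i k → k ∈ D i) (λ A⊑D h i k 0<p → A⊑D i (h i k 0<p))
      (λ cD h i k 0<p → shifted∈⇒⊑ cD h i (pos⇒∈ p-on 0<p)) faces cB (b ⊕ N ⊙ q , bᴺ-on , ~-refl)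
      where
      faces : ∀ {F D f t} → IsCell F → IsCell D → F ⊑ D → (∀ i k → 0ℚ < p i k → k ∈ D i) → Strict F f →
              0ℚ ≤ t → t ≤ 1ℚ → f ~ mix (b ⊕ N ⊙ q) (a ⊕ N ⊙ p) t → ∀ i k → 0ℚ < p i k → k ∈ F i
      faces {F} {D} {f} {t} cF cD F⊑D supp fS 0≤t t≤1 f~ i k 0<p with k ∈? F i
      ... | yes k∈ = k∈
      ... | no  k∉ with c₀ , face₀ ← ⊑⇒face cF cD F⊑D = contradiction (≤-trans big (≤-trans (term≤sum (T≥0 i) k)
              (≤-trans (term≤sum (λ i → sum-nonneg (T≥0 i)) i) (≤-reflexive total)))) (<⇒≱ smaller)
        where
        c : Point d
        c = rank c₀
        face : Face F D c
        face = face-rank face₀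
        γ : Fin n → ℚ
        γ = level cF c
        w : Mat n d
        w = (1ℚ - t) ⊙ b ⊕ t ⊙ a
        w≥0 : ∀ i k → 0ℚ ≤ w i k
        w≥0 i k = 0≤+ (0≤* (≤⇒0≤- t≤1) (nonneg b-on i k)) (0≤* 0≤t (nonneg a-on i k))
        w-st : Stochastic w
        w-st i = trans (sum-+ (λ k → (1ℚ - t) * b i k) _) (trans (cong₂ _+_
          (trans (sum-* (1ℚ - t) (b i)) (cong ((1ℚ - t) *_) (bary-stochastic cB i)))
          (trans (sum-* t (a i)) (cong (t *_) (bary-stochastic cA i)))) (cancel t))
          where
          cancel : ∀ t → (1ℚ - t) * 1ℚ + t * 1ℚ ≡ 1ℚ
          cancel = solve-∀ ℚring
        f~g : f ~ N ⊙ p ⊕ w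
        f~g = ~-trans f~ (~-trans (~-pointwise λ i k → spread (a i k) (b i k) (p i k) (q i k) t N)
          (~-trans (~-⊕ (~-⊕ {r = ((1ℚ - t) * N) ⊙ q} (~-⊙ ((1ℚ - t) * N) (~-sym p~q)) (~-refl {r = (t * N) ⊙ p})) (~-refl {r = w}))
            (~-pointwise λ i k → collect (p i k) (w i k) t N)))
          where
          spread : ∀ a b p q t N → b + N * q + t * (a + N * p + - 1ℚ * (b + N * q)) ≡ (1ℚ - t) * N * q + t * N * p + ((1ℚ - t) * b + t * a)
          spread = solve-∀ ℚring
          collect : ∀ p w t N → (1ℚ - t) * N * p + t * N * p + w ≡ N * p + w
          collect = solve-∀ ℚring
        p-slack : ∀ i k → 0ℚ ≤ p i k * (γ i - c k)
        p-slack i k with 0ℚ <? p i k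
        ... | yes 0<p = 0≤* (nonneg p-on i k) (≤⇒0≤- (below-level cF face i k (supp i k 0<p)))
        ... | no p≯0 = ≤-reflexive (sym (trans (cong (_* (γ i - c k)) (ℚ.≤-antisym (ℚ.≮⇒≥ p≯0) (nonneg p-on i k))) (ℚ.*-zeroˡ (γ i - c k))))
        -- Off `D` the difference `γ i - c k` may be negative, but not below `- K`; the summand
        -- `K * w i k` makes all terms nonnegative. As `f` is tight, only this summand contributes
        -- to the total.
        T : Mat n d
        T i k = (N * p i k + w i k) * (γ i - c k) + K * w i k
        T≡ : ∀ i k → T i k ≡ N * (p i k * (γ i - c k)) + w i k * (γ i + (K - c k))
        T≡ i k = expand N (p i k) (w i k) (γ i) (c k) K
          where
          expand : ∀ N p w g c K → (N * p + w) * (g - c) + K * w ≡ N * (p * (g - c)) + w * (g + (K - c))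
          expand = solve-∀ ℚring
        w-part≥0 : ∀ i k → 0ℚ ≤ w i k * (γ i + (K - c k))
        w-part≥0 i k = 0≤* (w≥0 i k) (0≤+ (0≤rank c₀ _) (≤⇒0≤- (rank≤ c₀ k)))
        T≥0 : ∀ i k → 0ℚ ≤ T i k
        T≥0 i k = subst (0ℚ ≤_) (sym (T≡ i k)) (0≤+ (0≤* 0≤N (p-slack i k)) (w-part≥0 i k))
        total : sumFin (λ i → sumFin (T i)) ≡ K * sumFin {n} (λ _ → 1ℚ)
        total = trans (sum-cong λ i → sum-+ (λ k → (N * p i k + w i k) * (γ i - c k)) (λ k → K * w i k))
          (trans (sum-+ (λ i → sumFin λ k → (N * p i k + w i k) * (γ i - c k)) (λ i → sumFin λ k → K * w i k))
            (trans (cong₂ _+_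
              (trans (sym (pairing-~ γ c f~g)) (trans (sum-cong λ i → trans (sum-cong (tight c γ (strict⇒on fS) (at-level cF F⊑D face) i)) (sum-0 d)) (sum-0 n)))
              (trans (sum-cong λ i → trans (sum-* K (w i)) (cong (K *_) (w-st i))) (sum-* {n} K λ _ → 1ℚ)))
              (ℚ.+-identityˡ (K * sumFin {n} (λ _ → 1ℚ)))))
        smaller : K * sumFin {n} (λ _ → 1ℚ) < N
        smaller = 0<-⇒< (subst (0ℚ <_) (one (K * sumFin {n} (λ _ → 1ℚ))) 0<1)
          where
          one : ∀ x → 1ℚ ≡ 1ℚ + x - x
          one = solve-∀ ℚring
        1≤p : 1ℚ ≤ p i k
        1≤p with p-int i k
        ... | inj₁ p≡0 = contradiction (≤-reflexive p≡0) (<⇒≱ 0<p)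
        ... | inj₂ h   = h
        gap : 1ℚ ≤ γ i - c k
        gap = rank-gap c₀ (ℚ.≰⇒> λ h → k∉ (level⇒∈ cF face₀ i (supp i k 0<p) h))
        -- An entry of at least 1 times a rank gap of at least 1, scaled by `N`, already exceeds the
        -- total of all terms.
        big : N ≤ T i k
        big = ≤-trans (≤-trans (≤-reflexive (sym (ℚ.*-identityʳ N)))
                (*-monoʳ 0≤N (≤-trans gap (≤-trans (≤-reflexive (sym (ℚ.*-identityˡ (γ i - c k))))
                  (ℚ.*-monoʳ-≤-nonNeg (γ i - c k) {{nonNegative (≤-trans (<⇒≤ 0<1) gap)}} 1≤p)))))
              (≤-trans (≤-trans (≤-reflexive (sym (ℚ.+-identityʳ _))) (ℚ.+-monoʳ-≤ (N * (p i k * (γ i - c k))) (w-part≥0 i k)))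
                (≤-reflexive (sym (T≡ i k))))

  -- Closed walks of columns as pairs of matrices

  record Trace (D B : CellType n d) (k l : Fin d) : Set where
    field
      p q     : Mat n d
      p-on    : On D p
      q-on    : On B q
      p-int   : Integral p
      q-int   : Integral q
      p≡q     : ∀ i → rowSum p i ≡ rowSum q i
      balance : ∀ y → colSum q y + unit k y ≡ colSum p y + unit l y

  trace-edge : ∀ {D B i k l m} → k ∈ D i → l ∈ B i → Trace D B l m → Trace D B k m
  trace-edge {D} {B} {i} {k} {l} {m} k∈ l∈ t = record
    { p = edge i k ⊕ p ; q = edge i l ⊕ q
    ; p-on = on-⊕ (edge-on k∈) p-on ; q-on = on-⊕ (edge-on l∈) q-on
    ; p-int = Integral-⊕edge i k (nonneg p-on) p-int ; q-int = Integral-⊕edge i l (nonneg q-on) q-int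
    ; p≡q = λ x → trans (sum-+ (edge i k x) (p x)) (trans (cong₂ _+_ (trans (rowSum-edge i k x) (sym (rowSum-edge i l x))) (p≡q x))
        (sym (sum-+ (edge i l x) (q x))))
    ; balance = λ y → trans (cong (_+ unit k y) (trans (sum-+ (λ x → edge i l x y) (λ x → q x y)) (cong (_+ colSum q y) (colSum-edge i l y))))
        (trans (trans (shuffle (unit l y) (colSum q y) (unit k y)) (trans (cong (_+ unit k y) (balance y)) (shuffle′ (colSum p y) (unit m y) (unit k y))))
          (cong (_+ unit m y) (sym (trans (sum-+ (λ x → edge i k x y) (λ x → p x y)) (cong (_+ colSum p y) (colSum-edge i k y))))))
    }
    where
    open Trace t
    shuffle : ∀ a b c → a + b + c ≡ b + a + c
    shuffle = solve-∀ ℚring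
    shuffle′ : ∀ a b c → a + b + c ≡ c + a + b
    shuffle′ = solve-∀ ℚring

  -- For each arc of the walk `p` collects the source and `q` the target, both in the row of the
  -- arc. Row sums agree, and column sums differ only by the endpoints of the walk.
  trace : ∀ {D B k l} → Star (Link D B) k l → Trace D B k l
  trace ε = record
    { p = λ _ _ → 0ℚ ; q = λ _ _ → 0ℚ
    ; p-on = (λ _ _ → ≤-refl) , (λ _ _ _ → refl) ; q-on = (λ _ _ → ≤-refl) , (λ _ _ _ → refl)
    ; p-int = λ _ _ → inj₁ refl ; q-int = λ _ _ → inj₁ refl ; p≡q = λ _ → refl ; balance = λ _ → refl }
  trace ((i , k∈ , l∈) ◅ path) = trace-edge k∈ l∈ (trace path)

  -- The arc followed by the path is a closed walk, so its two matrices have equal margins.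
  -- Compatibility in one direction puts the source edge into `B`, in the other the target edge into
  -- `D`.
  cycle : ∀ {D B} → IsCell D → IsCell B → ∀ {i k l} → k ∈ D i → l ∈ B i → Star (Link D B) l k → k ∈ B i × l ∈ D i
  cycle {D} {B} cD cB {i} {k} {l} k∈ l∈ path =
    Compatibility.support⊑ cD cB {p} {q} p-on q-on p~q p-int i k (pos-edge i k (nonneg (Trace.p-on rest))) ,
    Compatibility.support⊑ cB cD {q} {p} q-on p-on (~-sym p~q) q-int i l (pos-edge i l (nonneg (Trace.q-on rest)))
    where
    rest : Trace D B l k
    rest = trace path
    open Trace (trace-edge k∈ l∈ rest)
    p~q : p ~ q
    p~q = p≡q , λ y → sym (cancel (colSum q y) (unit k y) (colSum p y) (balance y))
      where
      strip : ∀ a b → a ≡ a + b - b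
      strip = solve-∀ ℚring
      cancel : ∀ a b c → a + b ≡ c + b → a ≡ c
      cancel a b c eq = trans (strip a b) (trans (cong (_- b) eq) (sym (strip c b)))
    pos-edge : ∀ {r : Mat n d} i k → (∀ x y → 0ℚ ≤ r x y) → 0ℚ < (edge i k ⊕ r) i k
    pos-edge i k 0≤r = 0<+ˡ (subst (0ℚ <_) (sym (edge-self i k)) 0<1) (0≤r i k)

  -- Terminal components and the face selected by raising their level

  Meets : CellType n d → Subset d → Fin n → Set
  Meets D E i = ∃ λ k → k ∈ D i × k ∈ E

  meets? : ∀ D E i → Dec (Meets D E i)
  meets? D E i = any? λ k → k ∈? D i ×-dec k ∈? E

  _≟ˢ_ : (P Q : Subset d) → Dec (P ≡ Q)
  _≟ˢ_ = ≡-dec Bool._≟_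

  -- A row of `D` that meets `E` does so exactly in its entry of `B`. The field `differs` guarantees
  -- that replacing such rows by those of `B` makes progress.
  record Bridge (A B : CellType n d) : Set where
    field
      {D}      : CellType n d
      isCell   : IsCell D
      A⊑D      : A ⊑ D
      E        : Subset d
      B⇒D      : ∀ {i} → Meets D E i → ∀ {k} → k ∈ B i → k ∈ D i
      B⇒E      : ∀ {i} → Meets D E i → ∀ {k} → k ∈ B i → k ∈ E
      DE⇒B     : ∀ {i k} → k ∈ D i → k ∈ E → k ∈ B i
      differs  : ∃ λ i → Meets D E i × ¬ A i ≡ B i

  module _ {A B : CellType n d} (cA : IsCell A) (cB : IsCell B) (j : Fin n) (Aj≢Bj : ¬ A j ≡ B j) where

    -- `D` comes from a small move from `A` towards `B`, and `E` is a terminal component reached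
    -- from a column of `A j`. Any arc starting in `E` has a return path, so `cycle` applies to it.
    bridge : Bridge A B
    bridge = build (extend {A} {bary cA} {bary cB} cA (bary-strict cA) (nonneg (strict⇒on (bary-strict cB))))
      where
      build : Extension A (bary cA) (bary cB) → Bridge A B
      build (D , η , r , cD , A⊑D , 0<η , rS , r~) = record
        { isCell = cD ; A⊑D = A⊑D ; E = E
        ; B⇒D = λ (k , k∈D , k∈E) l∈ → proj₂ (exchange k∈D k∈E l∈)
        ; B⇒E = λ (k , k∈D , k∈E) l∈ → reach-closed top k∈E (_ , k∈D , l∈)
        ; DE⇒B = λ {i} k∈D k∈E → proj₁ (exchange k∈D k∈E (proj₂ (nonempty B cB i)))
        ; differs = progress }
        where
        open Reach (Link D B) (link? D B)
        a b : Mat n d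
        a = bary cA
        b = bary cB
        k₀ = proj₁ (nonempty A cA j)
        k₀∈ : k₀ ∈ A j
        k₀∈ = proj₂ (nonempty A cA j)
        top : Fin d
        top = proj₁ (terminal k₀)
        E : Subset d
        E = reach top
        exchange : ∀ {i k l} → k ∈ D i → k ∈ E → l ∈ B i → k ∈ B i × l ∈ D i
        exchange {i} {k} {l} k∈D k∈E l∈ = cycle cD cB k∈D l∈
          (proj₂ (proj₂ (terminal k₀)) (reach-closed top k∈E (i , k∈D , l∈)) ◅◅ reach⇒star top k∈E)
        B⇒E : ∀ {i} → Meets D E i → ∀ {k} → k ∈ B i → k ∈ E
        B⇒E (k , k∈D , k∈E) l∈ = reach-closed top k∈E (_ , k∈D , l∈)

        -- Suppose `A i ≡ B i` in all rows meeting `E`. The indicator potentials are then tight on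
        -- both `r` and `a ⊕ η ⊙ b`: rows of `D` meeting `E` lie in `E`, and the other rows of `B`
        -- avoid `E`. So no arc enters `E` from outside, although `k₀` lies outside, as `A j` and
        -- `B j` differ, and reaches `top`.
        progress : ∃ λ i → Meets D E i × ¬ A i ≡ B i
        progress with any? (λ i → meets? D E i ×-dec ¬? (A i ≟ˢ B i))
        ... | yes h   = h
        ... | no none = contradiction (self∈reach top) (star-closed (_∉ E) escape k₀∉E (proj₁ (proj₂ (terminal k₀))))
          where
          agree : ∀ {i} → Meets D E i → A i ≡ B i
          agree {i} m with A i ≟ˢ B i
          ... | yes eq = eq
          ... | no neq = contradiction (i , m , neq) none
          γ : Fin n → ℚ
          γ i = 𝟙 (meets? D E i)
          c : Point d
          c k = 𝟙 (k ∈? E)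
          C : CellType n d
          C i = A i ∪ B i
          s : Mat n d
          s = a ⊕ η ⊙ b
          s-on : On C s
          s-on = on-⊕ (on-mono (λ i k∈ → x∈p∪q⁺ (inj₁ k∈)) (strict⇒on (bary-strict cA)))
                      (on-⊙ (<⇒≤ 0<η) (on-mono (λ i k∈ → x∈p∪q⁺ (inj₂ k∈)) (strict⇒on (bary-strict cB))))
          s-slack : ∀ i k → s i k * (γ i - c k) ≤ 0ℚ
          s-slack i k with k ∈? C i
          ... | no k∉  = ≤-reflexive (trans (cong (_* (γ i - c k)) (off s-on i k k∉)) (ℚ.*-zeroˡ (γ i - c k)))
          ... | yes k∈ = ≤0⇒*≤0 (nonneg s-on i k) (subst (γ i - c k ≤_) (ℚ.+-inverseʳ (c k))
                  (ℚ.+-monoˡ-≤ (- c k) (𝟙-mono (meets? D E i) (k ∈? E) λ m → B⇒E m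
                    ([ subst (k ∈_) (agree m) , (λ k∈B → k∈B) ]′ (x∈p∪q⁻ (A i) (B i) k∈)))))
          slack : (∀ i k → r i k * (γ i - c k) ≡ 0ℚ) × (∀ i k → s i k * (γ i - c k) ≡ 0ℚ)
          slack = complementary-slackness γ c r~
            (on-slack c γ (strict⇒on rS) λ i k k∈ → 𝟙-mono (k ∈? E) (meets? D E i) λ k∈E → k , k∈ , k∈E) s-slack
          D⇒E : ∀ {i} → Meets D E i → ∀ {k} → k ∈ D i → k ∈ E
          D⇒E {i} m {k} k∈ = 𝟙≡1⇒ (k ∈? E) (trans
            (sym (-≡0⇒≡ {γ i} {c k} (0<*⇒≡0 {r i k} {γ i - c k} (pos rS i k k∈) (proj₁ slack i k)))) (𝟙-yes (meets? D E i) m))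
          B∌E : ∀ {i} → ¬ Meets D E i → ∀ {k} → k ∈ B i → k ∉ E
          B∌E {i} ¬m {k} k∈ k∈E = ¬m (𝟙≡1⇒ (meets? D E i) (trans
            (-≡0⇒≡ {γ i} {c k} (0<*⇒≡0 {s i k} {γ i - c k} 0<s (proj₂ slack i k))) (𝟙-yes (k ∈? E) k∈E)))
            where
            0<s : 0ℚ < s i k
            0<s = 0<+ʳ (nonneg (strict⇒on (bary-strict cA)) i k) (0<* 0<η (pos (bary-strict cB) i k k∈))
          k₀∉E : k₀ ∉ E
          k₀∉E k₀∈E = none (j , (k₀ , A⊑D j k₀∈ , k₀∈E) , Aj≢Bj)
          escape : ∀ {x y} → x ∉ E → Link D B x y → y ∉ E
          escape {x} x∉ (i , x∈ , y∈) with meets? D E i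
          ... | yes m = contradiction (D⇒E m x∈) x∉
          ... | no ¬m = B∌E ¬m y∈

  -- Raising the coordinates in E of a normal vector of A to the level t moves
  -- along the tropical segment from A towards B.
  module Sweep {A B : CellType n d} (cA : IsCell A) (cB : IsCell B) (br : Bridge A B) where
    open Bridge br
    c : Point d
    c = proj₁ (⊑⇒face cA isCell A⊑D)
    face : Face A D c
    face = proj₂ (⊑⇒face cA isCell A⊑D)

    γ : Fin n → ℚ
    γ i = c (proj₁ (nonempty A cA i))

    private
      c≤γ : ∀ {i k} → k ∈ D i → c k ≤ γ i
      c≤γ {i} k∈ = maximal face i (proj₂ (nonempty A cA i)) k∈

      γ≤c : ∀ {i k} → k ∈ A i → γ i ≤ c k
      γ≤c {i} k∈ = maximal face i k∈ (A⊑D i (proj₂ (nonempty A cA i)))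

      γ≤c⇒∈A : ∀ {i k} → k ∈ D i → γ i ≤ c k → k ∈ A i
      γ≤c⇒∈A {i} k∈ h = attains face i k∈ λ l∈ → ≤-trans (c≤γ l∈) h

    module _ (t : ℚ) where
      private
        h : Point d
        h k with k ∈? E
        ... | yes _ = c k ⊔ t
        ... | no  _ = c k

        c≤h : ∀ k → c k ≤ h k
        c≤h k with k ∈? E
        ... | yes _ = ℚ.p≤p⊔q (c k) t
        ... | no  _ = ≤-refl

        t≤h : ∀ {k} → k ∈ E → t ≤ h k
        t≤h {k} k∈ with k ∈? E
        ... | yes _ = ℚ.p≤q⊔p (c k) t
        ... | no k∉ = contradiction k∈ k∉

        h≤ : ∀ {k v} → c k ≤ v → t ≤ v → h k ≤ v
        h≤ {k} c≤v t≤v with k ∈? E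
        ... | yes _ = ℚ.⊔-lub c≤v t≤v
        ... | no  _ = c≤v

        h≡c : ∀ {k} → k ∉ E → h k ≡ c k
        h≡c {k} k∉ with k ∈? E
        ... | yes k∈ = contradiction k∈ k∉
        ... | no _   = refl

        ≤h⇒≤c : ∀ {k v} → t < v → v ≤ h k → v ≤ c k
        ≤h⇒≤c {k} {v} t<v v≤h = ℚ.≮⇒≥ λ c<v → <⇒≱ (below c<v) v≤h
          where
          below : c k < v → h k < v
          below c<v with k ∈? E
          ... | no _  = c<v
          ... | yes _ with ℚ.≤-total (c k) t
          ... | inj₁ c≤t = subst (_< v) (sym (ℚ.p≤q⇒p⊔q≡q c≤t)) t<v
          ... | inj₂ t≤c = subst (_< v) (sym (ℚ.p≥q⇒p⊔q≡p t≤c)) c<v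

        swept : Σ (CellType n d) λ A′ → IsCell A′ × (∀ i j → (j ∈ A′ i) ⇔ ((j ∈ D i) × (∀ k → k ∈ D i → h k ≤ h j)))
        swept = faceClosed D isCell h

      C : CellType n d
      C = proj₁ swept

      C-isCell : IsCell C
      C-isCell = proj₁ (proj₂ swept)

      private
        ∈C : ∀ {i k v} → (∀ {l} → l ∈ D i → h l ≤ v) → k ∈ D i → v ≤ h k → k ∈ C i
        ∈C {i} {k} bound k∈ v≤ = Equivalence.from (proj₂ (proj₂ swept) i k) (k∈ , λ l l∈ → ≤-trans (bound l∈) v≤)

        C⇒D : ∀ {i k} → k ∈ C i → k ∈ D i
        C⇒D {i} {k} k∈ = proj₁ (Equivalence.to (proj₂ (proj₂ swept) i k) k∈)

        C⇒≥ : ∀ {i k l v} → k ∈ C i → l ∈ D i → v ≤ h l → v ≤ h k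
        C⇒≥ {i} {k} k∈ l∈ v≤ = ≤-trans v≤ (proj₂ (Equivalence.to (proj₂ (proj₂ swept) i k) k∈) _ l∈)

        C⇒≥γ : ∀ {i k} → k ∈ C i → γ i ≤ h k
        C⇒≥γ {i} k∈ = C⇒≥ k∈ (A⊑D i (proj₂ (nonempty A cA i))) (c≤h _)

      misses⇒A : ∀ {i} → ¬ Meets D E i → C i ≡ A i
      misses⇒A {i} ¬m = ⊆-antisym
        (λ {k} k∈ → γ≤c⇒∈A (C⇒D k∈) (subst (γ i ≤_) (h≡c (∉E (C⇒D k∈))) (C⇒≥γ k∈)))
        (λ {k} k∈ → ∈C (λ l∈ → subst (_≤ γ i) (sym (h≡c (∉E l∈))) (c≤γ l∈)) (A⊑D i k∈) (≤-trans (γ≤c k∈) (c≤h k)))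
        where
        ∉E : ∀ {k} → k ∈ D i → k ∉ E
        ∉E k∈ k∈E = ¬m (_ , k∈ , k∈E)

      before⇒A : ∀ {i} → t < γ i → C i ≡ A i
      before⇒A {i} t<γ = ⊆-antisym
        (λ k∈ → γ≤c⇒∈A (C⇒D k∈) (≤h⇒≤c t<γ (C⇒≥γ k∈)))
        (λ {k} k∈ → ∈C (λ l∈ → h≤ (c≤γ l∈) (<⇒≤ t<γ)) (A⊑D i k∈) (≤-trans (γ≤c k∈) (c≤h k)))

      -- The maximum on `D i` remains `γ i`; it is attained on `A i` and now also on all of
      -- `D i ∩ E`, which is `B i`.
      at⇒A∪B : ∀ {i} → Meets D E i → t ≡ γ i → C i ≡ A i ∪ B i
      at⇒A∪B {i} m t≡γ = ⊆-antisym forth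
        (λ {k} k∈ → [ (λ k∈A → ∈C bound (A⊑D i k∈A) (≤-trans (γ≤c k∈A) (c≤h k))) ,
                      (λ k∈B → ∈C bound (B⇒D m k∈B) (≤-trans (≤-reflexive (sym t≡γ)) (t≤h (B⇒E m k∈B)))) ]′ (x∈p∪q⁻ (A i) (B i) k∈))
        where
        bound : ∀ {l} → l ∈ D i → h l ≤ γ i
        bound l∈ = h≤ (c≤γ l∈) (≤-reflexive t≡γ)
        forth : ∀ {k} → k ∈ C i → k ∈ A i ∪ B i
        forth {k} k∈ with k ∈? E
        ... | yes k∈E = x∈p∪q⁺ (inj₂ (DE⇒B (C⇒D k∈) k∈E))
        ... | no  k∉E = x∈p∪q⁺ (inj₁ (γ≤c⇒∈A (C⇒D k∈) (subst (γ i ≤_) (h≡c k∉E) (C⇒≥γ k∈))))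

      -- All of `D i ∩ E`, which is `B i`, is raised to `t`, while the rest of `D i` stays at most
      -- `γ i < t`.
      after⇒B : ∀ {i} → Meets D E i → γ i < t → C i ≡ B i
      after⇒B {i} m γ<t = ⊆-antisym forth
        (λ k∈ → ∈C (λ l∈ → h≤ (≤-trans (c≤γ l∈) (<⇒≤ γ<t)) ≤-refl) (B⇒D m k∈) (t≤h (B⇒E m k∈)))
        where
        forth : ∀ {k} → k ∈ C i → k ∈ B i
        forth {k} k∈ with k ∈? E | proj₂ (nonempty B cB i)
        ... | yes k∈E | _  = DE⇒B (C⇒D k∈) k∈E
        ... | no  k∉E | b∈ = contradiction
                (≤-trans (subst (t ≤_) (h≡c k∉E) (C⇒≥ k∈ (B⇒D m b∈) (t≤h (B⇒E m b∈)))) (c≤γ (C⇒D k∈))) (<⇒≱ γ<t)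

  -- Induction on the number of differing rows

  Eliminates : CellType n d → CellType n d → Fin n → Set
  Eliminates A B j = Σ (CellType n d) λ C → IsCell C × (C j ≡ A j ∪ B j) ×
    (∀ k → (C k ≡ A k) ⊎ (C k ≡ B k) ⊎ (C k ≡ A k ∪ B k))

  differ : CellType n d → CellType n d → Subset n
  differ A B = setOf (λ i → ¬? (A i ≟ˢ B i))

  -- The fuel bounds the number of rows in which `A` and `B` differ; each replacement of `A` makes
  -- at least one more row agree and spoils none.
  eliminate : ∀ fuel {A B} → IsCell A → IsCell B → ∀ j → ∣ differ A B ∣ ℕ.≤ fuel → Eliminates A B j
  eliminate fuel {A} {B} cA cB j ≤fuel with A j ≟ˢ B j
  ... | yes eq = A , cA , trans (sym (∪-idem (A j))) (cong (A j ∪_) eq) , λ k → inj₁ refl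
  ... | no neq = use (bridge cA cB j neq)
    where
    use : Bridge A B → Eliminates A B j
    use br = decide (meets? D E j)
      where
      open Bridge br
      open Sweep cA cB br
      decide : Dec (Meets D E j) → Eliminates A B j
      -- Level `γ j` ties row `j`; any other row meeting `E` is before, at or after its own tie.
      decide (yes m) = C (γ j) , C-isCell (γ j) , at⇒A∪B (γ j) m refl , each
        where
        each : ∀ k → (C (γ j) k ≡ A k) ⊎ (C (γ j) k ≡ B k) ⊎ (C (γ j) k ≡ A k ∪ B k)
        each k with meets? D E k | ℚ.<-cmp (γ j) (γ k)
        ... | no ¬m | _            = inj₁ (misses⇒A (γ j) ¬m)
        ... | yes m | tri< t<γ _ _ = inj₁ (before⇒A (γ j) t<γ)
        ... | yes m | tri≈ _ t≡γ _ = inj₂ (inj₂ (at⇒A∪B (γ j) m t≡γ))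
        ... | yes m | tri> _ _ γ<t = inj₂ (inj₁ (after⇒B (γ j) m γ<t))
      decide (no ¬m) = recurse fuel ≤fuel
        where
        -- A level above all `γ i` turns every row meeting `E` into that of `B`, while row `j`,
        -- which misses `E`, keeps `A j`.
        t : ℚ
        t = proj₁ (upper-bound γ)
        toB : ∀ {i} → Meets D E i → C t i ≡ B i
        toB {i} m = after⇒B t m (proj₂ (upper-bound γ) i)
        smaller : ∣ differ (C t) B ∣ ℕ.< ∣ differ A B ∣
        smaller = p⊂q⇒∣p∣<∣q∣
          ( (λ {i} i∈ → ∈-setOf⁺ (λ i → ¬? (A i ≟ˢ B i)) λ A≡B → ∈-setOf⁻ (λ i → ¬? (C t i ≟ˢ B i)) i∈ (still i A≡B))
          , proj₁ differs , ∈-setOf⁺ (λ i → ¬? (A i ≟ˢ B i)) (proj₂ (proj₂ differs))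
          , λ i∈ → ∈-setOf⁻ (λ i → ¬? (C t i ≟ˢ B i)) i∈ (toB (proj₁ (proj₂ differs))) )
          where
          still : ∀ i → A i ≡ B i → C t i ≡ B i
          still i A≡B with meets? D E i
          ... | yes m = toB m
          ... | no ¬m = trans (misses⇒A t ¬m) A≡B
        recurse : ∀ fuel → ∣ differ A B ∣ ℕ.≤ fuel → Eliminates A B j
        recurse zero       le = contradiction (ℕ.≤-trans smaller le) λ ()
        recurse (suc fuel) le = transfer (eliminate fuel (C-isCell t) cB j (ℕ.≤-pred (ℕ.≤-trans smaller le)))
          where
          transfer : Eliminates (C t) B j → Eliminates A B j
          transfer (C′ , cC′ , C′j , each) = C′ , cC′ , trans C′j (cong (_∪ B j) (misses⇒A t ¬m)) , each′
            where
            each′ : ∀ k → (C′ k ≡ A k) ⊎ (C′ k ≡ B k) ⊎ (C′ k ≡ A k ∪ B k)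
            -- In rows meeting `E` the replacement equals `B k`, so all three alternatives collapse
            -- to `B k`; in the other rows it equals `A k`.
            each′ k with meets? D E k | each k
            ... | _     | inj₂ (inj₁ eq) = inj₂ (inj₁ eq)
            ... | yes m | inj₁ eq        = inj₂ (inj₁ (trans eq (toB m)))
            ... | yes m | inj₂ (inj₂ eq) = inj₂ (inj₁ (trans eq (trans (cong (_∪ B k) (toB m)) (∪-idem (B k)))))
            ... | no ¬m | inj₁ eq        = inj₁ (trans eq (misses⇒A t ¬m))
            ... | no ¬m | inj₂ (inj₂ eq) = inj₂ (inj₂ (trans eq (cong (_∪ B k) (misses⇒A t ¬m))))

theorem6p9 : (n d : ℕ) (S : MixedSubdivision n d) → Elimination (MixedSubdivision.IsCell S)
theorem6p9 n d S A B cA cB j = Subdivision.eliminate S _ cA cB j ℕ.≤-refl
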